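{- Fix integers $k>3$ and $2\le r\le k$. Let $H$ be the binomial random $k$-uniform hypergraph $\mathbb{G}_k(n,n^{3-k})$ on $n$ vertices, in which each of the $\binom nk$ possible edges is present independently with probability $n^{3-k}$. Then there is a constant $C=C(k,r)$ such that with probability $1-o(1)$ as $n\to\infty$, every $r$-cut of $H$ has excess at most $Cn^2$ (and $Cn^2=O(m^{2/3})$, where $m$ is the number of edges of $H$).
   Context: For $2\le r\le k$, an $r$-cut of a $k$-uniform hypergraph $H$ is a partition of $V(H)$ into $r$ labelled parts; its size is the number of edges having a vertex in every part. The excess of an $r$-cut of an $m$-edge $k$-uniform hypergraph is its size minus $\frac{S(k,r)r!}{r^k}m$, where $S(k,r)$ is the Stirling number of the second kind. -}

module Defs where

open import Data.Bool using (Bool; true; false; _∧_; T)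
open import Data.Nat as ℕ using (ℕ; zero; suc; _^_; _∸_)
open import Data.Nat using (_!)
open import Data.Fin using (Fin)
open import Data.Fin.Subset using (Subset; ∣_∣)
open import Data.Vec using (Vec; []; _∷_; lookup)
open import Data.List using (List; []; _∷_; map; _++_; concatMap; filter; length; allFin; foldr)
open import Data.Bool.ListAction using (all; any)
open import Data.Product using (_×_; _,_; proj₁; proj₂)
open import Data.Integer using (+_)
open import Data.Rational using (ℚ; 0ℚ; 1ℚ; _/_; _+_; _-_; _*_; _≤ᵇ_)
open import Relation.Binary.PropositionalEquality using (_≡_)

stirling2 : ℕ → ℕ → ℕ
stirling2 zero    zero    = 1
stirling2 zero    (suc k) = 0
stirling2 (suc n) zero    = 0
stirling2 (suc n) (suc k) = suc k ℕ.* stirling2 n (suc k) ℕ.+ stirling2 n k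

-- a / d as a rational; the case d = 0 is a junk value never used below
-- (all denominators used are positive).

_÷_ : ℕ → ℕ → ℚ
a ÷ zero    = 0ℚ
a ÷ suc d   = (+ a) / suc d

ι : ℕ → ℚ
ι a = (+ a) / 1

vecsOver : {A : Set} → List A → (n : ℕ) → List (Vec A n)
vecsOver xs zero    = [] ∷ []
vecsOver xs (suc n) = concatMap (λ x → map (x ∷_) (vecsOver xs n)) xs

allSubsets : (n : ℕ) → List (Subset n)
allSubsets n = vecsOver (true ∷ false ∷ []) n

kSets : (n k : ℕ) → List (Subset n)
kSets n k = filter (λ s → ∣ s ∣ ℕ.≟ k) (allSubsets n)

Hypergraph : ℕ → Set
Hypergraph n = List (Subset n)

-- Independent inclusion: every element of xs is included independently
-- with probability p.  Result: list of (probability, outcome) pairs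
-- covering every sub-list of xs exactly once.

indep : {A : Set} → ℚ → List A → List (ℚ × List A)
indep p []       = (1ℚ , []) ∷ []
indep p (x ∷ xs) =
  map (λ wS → (p * proj₁ wS , x ∷ proj₂ wS)) (indep p xs) ++
  map (λ wS → ((1ℚ - p) * proj₁ wS , proj₂ wS)) (indep p xs)

-- edge probability n^(3-k) = 1 / n^(k-3)  (k > 3); junk value at n = 0
edgeProb : (k n : ℕ) → ℚ
edgeProb k n = 1 ÷ (n ^ (k ∸ 3))

Gk : (k n : ℕ) → List (ℚ × Hypergraph n)
Gk k n = indep (edgeProb k n) (kSets n k)

Prob : (k n : ℕ) → (Hypergraph n → Bool) → ℚ
Prob k n E = foldr (λ wH acc → (if E (proj₂ wH) then proj₁ wH else 0ℚ) + acc) 0ℚ (Gk k n)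
  where
  if_then_else_ : {A : Set} → Bool → A → A → A
  if true  then a else b = a
  if false then a else b = b

-- an r-cut of a hypergraph on Fin n: a labelled partition of the vertex
-- set into r parts, i.e. a map vertex ↦ part (parts may be empty)
Cut : (n r : ℕ) → Set
Cut n r = Vec (Fin r) n

allCuts : (n r : ℕ) → List (Cut n r)
allCuts n r = vecsOver (allFin r) n

_≡ᶠ_ : {r : ℕ} → Fin r → Fin r → Bool
i ≡ᶠ j = Data.Fin.toℕ i ℕ.≡ᵇ Data.Fin.toℕ j
  where import Data.Fin

crosses : {n r : ℕ} → Cut n r → Subset n → Bool
crosses {n} {r} c e = all (λ j → any (λ v → lookup e v ∧ (lookup c v ≡ᶠ j)) (allFin n)) (allFin r)

cutSize : {n r : ℕ} → Hypergraph n → Cut n r → ℕ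
cutSize H c = length (filter (λ e → Data.Bool._≟_ (crosses c e) true) H)
  where import Data.Bool

edges : {n : ℕ} → Hypergraph n → ℕ
edges H = length H

excess : {n : ℕ} (k r : ℕ) → Hypergraph n → Cut n r → ℚ
excess k r H c = ι (cutSize H c) - ((stirling2 k r ℕ.* (r !)) ÷ (r ^ k)) * ι (edges H)

-- the event of the theorem, for constants C and D:
--   every r-cut of H has excess at most C n²,  and  C n² ≤ D m^(2/3)
--   (the latter written as (C n²)³ ≤ D³ m², equivalent for nonnegatives)
goodEvent : (k r C D n : ℕ) → Hypergraph n → Bool
goodEvent k r C D n H =
  all (λ c → excess k r H c ≤ᵇ ι (C ℕ.* n ^ 2)) (allCuts n r)
  ∧ ((C ℕ.* n ^ 2) ^ 3 ℕ.≤ᵇ D ^ 3 ℕ.* edges H ^ 2)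

{-# OPTIONS --safe #-}
module Submission where

-- The number of k-sets meeting every part of a cut with part sizes x₁, …, x_r is, by
-- inclusion-exclusion, the iterated difference Δ_{x₁} ⋯ Δ_{x_r} C(t, k) at t = 0.  Since
-- t^k − k! C(t, k) is absolutely monotone (all its iterated differences are nonnegative), this is
-- at most Δ_{x₁} ⋯ Δ_{x_r} t^k / k!.  For an absolutely monotone function, moving two steps
-- towards each other only increases the iterated difference, so equal parts are extremal and at
-- most S(k,r) r! / r^k · n^k / k! of the k-sets cross any cut.  After multiplication by n^(3−k) the
-- expected excess of each cut is therefore O(n²).  The exponential moments of the cut sizes and of
-- the number of edges with base 1 ± δ, δ = Θ(1/n), bound the probability of a deviation by C n²
-- by 2^(−Ω(C n)), which beats the union bound over the r^n cuts.

open import Defs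
open import Level using (0ℓ)
open import Algebra.Bundles using (CommutativeRing)
open import Data.Bool as Bool using (Bool; true; false; not; _∧_; _∨_; T)
import Data.Bool.Properties as Bool
open import Data.Bool.ListAction using (all; any)
open import Data.Fin as Fin using (Fin)
import Data.Fin.Properties as Fin
open import Data.Fin.Subset using (Subset; ∣_∣)
open import Data.Integer as ℤ using (ℤ; +_; 0ℤ; 1ℤ)
import Data.Integer.Properties as ℤ
import Data.Integer.Tactic.RingSolver as ℤ-Ring
open import Data.List using (List; []; _∷_; _++_; map; length; replicate; filter; foldr; allFin; tabulate; concatMap)
open import Data.List.Properties using (map-replicate; length-map; length-++; length-tabulate; ++-identityʳ)
open import Data.List.Membership.Propositional using (_∈_)
open import Data.List.Membership.Propositional.Properties using (∈-allFin)
open import Data.List.Relation.Binary.Permutation.Propositional as ↭ using (_↭_)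
open import Data.List.Relation.Binary.Permutation.Propositional.Properties using (↭-length)
open import Data.List.Relation.Unary.All as All using (All; []; _∷_)
import Data.List.Relation.Unary.All.Properties as All
open import Data.List.Relation.Unary.Any using (here; there)
open import Data.List.Relation.Unary.Unique.Propositional using (Unique; []; _∷_)
open import Data.List.Relation.Unary.Unique.Propositional.Properties using (allFin⁺)
open import Data.Nat as ℕ using (ℕ; zero; suc; _≤_; _<_; z≤n; s≤s; _!)
open import Data.Nat.Combinatorics using (nCk+nC[k+1]≡[n+1]C[k+1]) renaming (_C_ to _choose_)
import Data.Nat.DivMod as ℕ
open import Data.Nat.ListAction using (sum)
open import Data.Nat.ListAction.Properties using (sum-↭)
import Data.Nat.Properties as ℕ
import Data.Nat.Tactic.RingSolver as ℕ-Ring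
open import Data.Product using (Σ; ∃; ∃₂; _×_; _,_; proj₁; proj₂)
open import Data.Rational as ℚ using (ℚ; 0ℚ; 1ℚ; _+_; _*_; _-_; -_; nonNegative; positive; toℚᵘ) renaming (_≤_ to _≤ℚ_; _<_ to _<ℚ_)
import Data.Rational.Properties as ℚ
import Data.Rational.Unnormalised as ℚᵘ
import Data.Rational.Unnormalised.Properties as ℚᵘ
open import Data.Sum using (inj₁; inj₂)
open import Data.Vec using ([]; _∷_; lookup)
import Data.Vec as Vec
open import Function using (_∘_; const; id)
open import Function.Bundles using (module Equivalence)
open import Relation.Binary.PropositionalEquality as ≡ using (_≡_; _≢_; refl; cong; cong₂; sym; trans; subst; module ≡-Reasoning)
open import Relation.Nullary using (yes; no; contradiction; does)
open import Relation.Nullary.Decidable using (dec⇒maybe)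
open import Relation.Unary using (Pred; Decidable)
open import Tactic.RingSolver using (solve-∀)
open import Tactic.RingSolver.Core.AlmostCommutativeRing using (AlmostCommutativeRing; fromCommutativeRing)
open import Algebra.Properties.CommutativeSemiring.Exp (CommutativeRing.commutativeSemiring ℚ.+-*-commutativeRing) using (_^_; ^-homo-*; ^-assocʳ; ^-distrib-*)

-- Absolutely monotone functions

-- Two separate effects make n² the right scale. The gap between n^k / k! and C(n, k) is O(n^(k-1)),
-- which the edge probability n^(3-k) turns into O(n²). A cut size is binomial with mean O(n³), so
-- it fluctuates by O(n^(3/2)), and a union over exponentially many cuts costs a further factor √n.
-- With δ of order 1/n the second-order term n³ δ² of the exponential moment is of order n, the same
-- as the logarithm of the number of cuts. The excess compares a cut with the actual number of edges
-- rather than its mean, and it decreases in that number; hence the lower tail of the edge count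
-- enters. That tail also yields Ω(n³) edges, which is the claim C n² = O(m^(2/3)). All
-- probabilities are rational, so the inequality (1 + 1/N)^N ≥ 2 takes the place of the exponential
-- function, and estimates are kept in multiplied-out form instead of being divided.

Δ : ℕ → (ℕ → ℤ) → ℕ → ℤ
Δ u f t = f (t ℕ.+ u) ℤ.- f t

Δs : List ℕ → (ℕ → ℤ) → ℕ → ℤ
Δs []       f = f
Δs (u ∷ us) f = Δs us (Δ u f)

Δs-cong : ∀ us {f g : ℕ → ℤ} → (∀ t → f t ≡ g t) → ∀ t → Δs us f t ≡ Δs us g t
Δs-cong []       f≗g = f≗g
Δs-cong (u ∷ us) f≗g = Δs-cong us (λ t → cong₂ ℤ._-_ (f≗g (t ℕ.+ u)) (f≗g t))

+-interchange-- : ∀ a b c d → (a ℤ.+ b) ℤ.- (c ℤ.+ d) ≡ (a ℤ.- c) ℤ.+ (b ℤ.- d)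
+-interchange-- = ℤ-Ring.solve-∀

Δs-+ : ∀ us (f g : ℕ → ℤ) t → Δs us (λ t → f t ℤ.+ g t) t ≡ Δs us f t ℤ.+ Δs us g t
Δs-+ []       f g t = refl
Δs-+ (u ∷ us) f g t = trans
  (Δs-cong us (λ t → +-interchange-- (f (t ℕ.+ u)) (g (t ℕ.+ u)) (f t) (g t)) t)
  (Δs-+ us (Δ u f) (Δ u g) t)

Δs-*ˡ : ∀ us c (f : ℕ → ℤ) t → Δs us (λ t → c ℤ.* f t) t ≡ c ℤ.* Δs us f t
Δs-*ˡ []       c f t = refl
Δs-*ˡ (u ∷ us) c f t = trans
  (Δs-cong us (λ t → distrib c (f (t ℕ.+ u)) (f t)) t)
  (Δs-*ˡ us c (Δ u f) t)
  where
  distrib : ∀ c a b → c ℤ.* a ℤ.- c ℤ.* b ≡ c ℤ.* (a ℤ.- b)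
  distrib = ℤ-Ring.solve-∀

+-right-comm : ∀ a b c → a ℕ.+ b ℕ.+ c ≡ a ℕ.+ c ℕ.+ b
+-right-comm = ℕ-Ring.solve-∀

Δs-shift : ∀ us v (f : ℕ → ℤ) t → Δs us (λ t → f (t ℕ.+ v)) t ≡ Δs us f (t ℕ.+ v)
Δs-shift []       v f t = refl
Δs-shift (u ∷ us) v f t = trans
  (Δs-cong us (λ t → cong (λ a → f a ℤ.- f (t ℕ.+ v)) (+-right-comm t u v)) t)
  (Δs-shift us v (Δ u f) t)

-- Differences commute, so the head step, which `Δs` applies to the function first, may also be
-- applied last. In this form an iterated difference follows the recursion of inclusion-exclusion.
Δs-Δ : ∀ us u (f : ℕ → ℤ) t → Δs (u ∷ us) f t ≡ Δs us f (t ℕ.+ u) ℤ.- Δs us f t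
Δs-Δ []        u f t = refl
Δs-Δ (v ∷ us) u f t = trans (Δs-cong us comm t) (Δs-Δ us u (Δ v f) t)
  where
  exchange : ∀ a b c d → (a ℤ.- b) ℤ.- (c ℤ.- d) ≡ (a ℤ.- c) ℤ.- (b ℤ.- d)
  exchange = ℤ-Ring.solve-∀
  comm : ∀ t → Δ v (Δ u f) t ≡ Δ u (Δ v f) t
  comm t = trans
    (exchange (f (t ℕ.+ v ℕ.+ u)) (f (t ℕ.+ v)) (f (t ℕ.+ u)) (f t))
    (cong (λ a → (f a ℤ.- f (t ℕ.+ u)) ℤ.- (f (t ℕ.+ v) ℤ.- f t)) (+-right-comm t v u))

Δs-↭ : ∀ {us vs} → us ↭ vs → ∀ (f : ℕ → ℤ) t → Δs us f t ≡ Δs vs f t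
Δs-↭ ↭.refl         f t = refl
Δs-↭ (↭.prep u p)   f t = Δs-↭ p (Δ u f) t
Δs-↭ (↭.swap {us} {vs} u v p) f t = trans (Δs-cong us comm t) (Δs-↭ p (Δ u (Δ v f)) t)
  where
  comm : ∀ t → Δ v (Δ u f) t ≡ Δ u (Δ v f) t
  comm t = Δs-Δ (v ∷ []) u f t
Δs-↭ (↭.trans p q)  f t = trans (Δs-↭ p f t) (Δs-↭ q f t)

Δs-scale : ∀ us c (f : ℕ → ℤ) t → Δs (map (c ℕ.*_) us) f (c ℕ.* t) ≡ Δs us (λ t → f (c ℕ.* t)) t
Δs-scale []       c f t = refl
Δs-scale (u ∷ us) c f t = trans (Δs-scale us c (Δ (c ℕ.* u) f) t)
  (Δs-cong us (λ t → cong (λ a → f a ℤ.- f (c ℕ.* t)) (sym (ℕ.*-distribˡ-+ c t u))) t)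

-- A discrete form of Bernstein's absolutely monotone functions. Steps of every length are allowed,
-- and the empty list makes f itself nonnegative.
AbsMonotone : (ℕ → ℤ) → Set
AbsMonotone f = ∀ us t → 0ℤ ℤ.≤ Δs us f t

am-cong : ∀ {f g : ℕ → ℤ} → (∀ t → f t ≡ g t) → AbsMonotone f → AbsMonotone g
am-cong f≗g am us t = subst (0ℤ ℤ.≤_) (Δs-cong us f≗g t) (am us t)

am-+ : ∀ {f g : ℕ → ℤ} → AbsMonotone f → AbsMonotone g → AbsMonotone (λ t → f t ℤ.+ g t)
am-+ {f} {g} amf amg us t =
  subst (0ℤ ℤ.≤_) (sym (Δs-+ us f g t)) (ℤ.+-mono-≤ (amf us t) (amg us t))

am-*ˡ : ∀ n {f : ℕ → ℤ} → AbsMonotone f → AbsMonotone (λ t → + n ℤ.* f t)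
am-*ˡ n {f} am us t = subst (0ℤ ℤ.≤_) (sym (Δs-*ˡ us (+ n) f t))
  (subst (ℤ._≤ + n ℤ.* Δs us f t) (ℤ.*-zeroʳ (+ n)) (ℤ.*-monoˡ-≤-nonNeg (+ n) (am us t)))

am-shift : ∀ v {f : ℕ → ℤ} → AbsMonotone f → AbsMonotone (λ t → f (t ℕ.+ v))
am-shift v {f} am us t = subst (0ℤ ℤ.≤_) (sym (Δs-shift us v f t)) (am us (t ℕ.+ v))

am-Δ : ∀ u {f : ℕ → ℤ} → AbsMonotone f → AbsMonotone (Δ u f)
am-Δ u am us = am (u ∷ us)

-- The discrete Leibniz rule splits a difference of t f(t) into t times a difference of f and a
-- multiple of a shift of f; both are covered by a shorter list of steps, since f is arbitrary in
-- the induction.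
am-id* : ∀ {f : ℕ → ℤ} → AbsMonotone f → AbsMonotone (λ t → + t ℤ.* f t)
am-id* {f} am [] t = am-*ˡ t am [] t
am-id* {f} am (u ∷ us) t = subst (0ℤ ℤ.≤_)
  (sym (trans (Δs-cong us leibniz t) (Δs-+ us _ _ t)))
  (ℤ.+-mono-≤ (am-id* (am-Δ u am) us t) (am-*ˡ u (am-shift u am) us t))
  where
  expand : ∀ t u a b → (t ℤ.+ u) ℤ.* a ℤ.- t ℤ.* b ≡ t ℤ.* (a ℤ.- b) ℤ.+ u ℤ.* a
  expand = ℤ-Ring.solve-∀
  leibniz : ∀ t → Δ u (λ t → + t ℤ.* f t) t ≡ + t ℤ.* Δ u f t ℤ.+ + u ℤ.* f (t ℕ.+ u)
  leibniz t = expand (+ t) (+ u) (f (t ℕ.+ u)) (f t)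

am-const : ∀ n → AbsMonotone (const (+ n))
am-const n []       t = ℤ.+≤+ z≤n
am-const n (u ∷ us) t = subst (0ℤ ℤ.≤_)
  (Δs-cong us (λ _ → sym (ℤ.+-inverseʳ (+ n))) t) (am-const 0 us t)

-- Absolute monotonicity of powers and binomial coefficients

power : ℕ → ℕ → ℤ
power k t = (+ t) ℤ.^ k

am-power : ∀ k → AbsMonotone (power k)
am-power zero    = am-const 1
am-power (suc k) = am-id* (am-power k)

binomial : ℕ → ℕ → ℤ
binomial k t = + (t choose k)

-- By Pascal's rule a unit difference lowers k by one, and a step of length u is a sum of u shifted
-- unit steps. Every first difference is therefore a sum of shifts of `binomial k`.
am-binomial : ∀ k → AbsMonotone (binomial k)
am-binomial zero = am-const 1
am-binomial (suc k) []       t = ℤ.+≤+ z≤n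
am-binomial (suc k) (u ∷ us) t = am-Δ-binomial u us t
  where
  Δ-suc : ∀ u t → Δ u (binomial (suc k)) t ℤ.+ binomial k (t ℕ.+ u) ≡ Δ (suc u) (binomial (suc k)) t
  Δ-suc u t = begin
    + ((t ℕ.+ u) choose suc k) ℤ.- + (t choose suc k) ℤ.+ + ((t ℕ.+ u) choose k)
      ≡⟨ rotate (+ ((t ℕ.+ u) choose suc k)) (+ (t choose suc k)) (+ ((t ℕ.+ u) choose k)) ⟩
    + ((t ℕ.+ u) choose k) ℤ.+ + ((t ℕ.+ u) choose suc k) ℤ.- + (t choose suc k)
      ≡⟨ cong (λ a → + a ℤ.- + (t choose suc k)) (nCk+nC[k+1]≡[n+1]C[k+1] (t ℕ.+ u) k) ⟩
    + (suc (t ℕ.+ u) choose suc k) ℤ.- + (t choose suc k)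
      ≡⟨ cong (λ a → + (a choose suc k) ℤ.- + (t choose suc k)) (sym (ℕ.+-suc t u)) ⟩
    Δ (suc u) (binomial (suc k)) t ∎
    where
    open ≡-Reasoning
    rotate : ∀ a b c → a ℤ.- b ℤ.+ c ≡ c ℤ.+ a ℤ.- b
    rotate = ℤ-Ring.solve-∀
  am-Δ-binomial : ∀ u → AbsMonotone (Δ u (binomial (suc k)))
  am-Δ-binomial zero = am-cong
    (λ t → sym (trans (cong (λ a → + (a choose suc k) ℤ.- + (t choose suc k)) (ℕ.+-identityʳ t))
                        (ℤ.+-inverseʳ (+ (t choose suc k)))))
    (am-const 0)
  am-Δ-binomial (suc u) = am-cong (Δ-suc u) (am-+ (am-Δ-binomial u) (am-shift u (am-binomial k)))

-- The absorption identity (n - k) C(n, k) = (k + 1) C(n, k + 1), with the subtracted term moved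
-- across so that it also holds for n < k.
n*nCk : ∀ n k → n ℕ.* (n choose k) ≡ suc k ℕ.* (n choose suc k) ℕ.+ k ℕ.* (n choose k)
n*nCk zero    zero    = refl
n*nCk zero    (suc k) = sym (trans (cong (ℕ._+ k ℕ.* 0) (ℕ.*-zeroʳ k)) (ℕ.*-zeroʳ k))
n*nCk (suc n) zero    = begin
  suc n ℕ.* 1                          ≡⟨ lhs n ⟩
  1 ℕ.+ n ℕ.* 1                        ≡⟨ cong (1 ℕ.+_) (n*nCk n 0) ⟩
  1 ℕ.+ (1 ℕ.* (n choose 1) ℕ.+ 0)          ≡⟨ rhs (n choose 1) ⟩
  1 ℕ.* (1 ℕ.+ n choose 1) ℕ.+ 0            ≡⟨ cong (λ a → 1 ℕ.* a ℕ.+ 0) (nCk+nC[k+1]≡[n+1]C[k+1] n 0) ⟩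
  1 ℕ.* (suc n choose 1) ℕ.+ 0              ∎
  where
  open ≡-Reasoning
  lhs : ∀ n → suc n ℕ.* 1 ≡ 1 ℕ.+ n ℕ.* 1
  lhs = ℕ-Ring.solve-∀
  rhs : ∀ a → 1 ℕ.+ (1 ℕ.* a ℕ.+ 0) ≡ 1 ℕ.* (1 ℕ.+ a) ℕ.+ 0
  rhs = ℕ-Ring.solve-∀
n*nCk (suc n) (suc k) = begin
  suc n ℕ.* (suc n choose suc k)
    ≡⟨ cong (suc n ℕ.*_) (sym (nCk+nC[k+1]≡[n+1]C[k+1] n k)) ⟩
  suc n ℕ.* (c₀ ℕ.+ c₁)
    ≡⟨ lhs n c₀ c₁ ⟩
  (n ℕ.* c₀ ℕ.+ n ℕ.* c₁) ℕ.+ (c₀ ℕ.+ c₁)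
    ≡⟨ cong (ℕ._+ (c₀ ℕ.+ c₁)) (cong₂ ℕ._+_ (n*nCk n k) (n*nCk n (suc k))) ⟩
  ((suc k ℕ.* c₁ ℕ.+ k ℕ.* c₀) ℕ.+ (suc (suc k) ℕ.* c₂ ℕ.+ suc k ℕ.* c₁)) ℕ.+ (c₀ ℕ.+ c₁)
    ≡⟨ rhs k c₀ c₁ c₂ ⟩
  suc (suc k) ℕ.* (c₁ ℕ.+ c₂) ℕ.+ suc k ℕ.* (c₀ ℕ.+ c₁)
    ≡⟨ cong₂ (λ a b → suc (suc k) ℕ.* a ℕ.+ suc k ℕ.* b)
         (nCk+nC[k+1]≡[n+1]C[k+1] n (suc k)) (nCk+nC[k+1]≡[n+1]C[k+1] n k) ⟩
  suc (suc k) ℕ.* (suc n choose suc (suc k)) ℕ.+ suc k ℕ.* (suc n choose suc k) ∎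
  where
  open ≡-Reasoning
  c₀ = n choose k
  c₁ = n choose suc k
  c₂ = n choose suc (suc k)
  lhs : ∀ n a b → suc n ℕ.* (a ℕ.+ b) ≡ (n ℕ.* a ℕ.+ n ℕ.* b) ℕ.+ (a ℕ.+ b)
  lhs = ℕ-Ring.solve-∀
  rhs : ∀ k a b c →
    ((suc k ℕ.* b ℕ.+ k ℕ.* a) ℕ.+ (suc (suc k) ℕ.* c ℕ.+ suc k ℕ.* b)) ℕ.+ (a ℕ.+ b)
    ≡ suc (suc k) ℕ.* (b ℕ.+ c) ℕ.+ suc k ℕ.* (a ℕ.+ b)
  rhs = ℕ-Ring.solve-∀

-- The number k! C(n, k) is the falling factorial n (n - 1) ⋯ (n - k + 1); this is its recursion,
-- again without subtraction.
n*k!*nCk : ∀ n k → n ℕ.* (k ! ℕ.* (n choose k)) ≡ suc k ! ℕ.* (n choose suc k) ℕ.+ k ℕ.* (k ! ℕ.* (n choose k))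
n*k!*nCk n k = trans (lhs n (k !) (n choose k))
  (trans (cong (k ! ℕ.*_) (n*nCk n k)) (rhs k (k !) (n choose k) (n choose suc k)))
  where
  lhs : ∀ n f c → n ℕ.* (f ℕ.* c) ≡ f ℕ.* (n ℕ.* c)
  lhs = ℕ-Ring.solve-∀
  rhs : ∀ k f c c′ → f ℕ.* (suc k ℕ.* c′ ℕ.+ k ℕ.* c) ≡ (suc k ℕ.* f) ℕ.* c′ ℕ.+ k ℕ.* (f ℕ.* c)
  rhs = ℕ-Ring.solve-∀

-- t^(k+1) − (k+1)! C(t,k+1) = t (t^k − k! C(t,k)) + k k! C(t,k),
-- and absolute monotonicity is preserved by multiplication by t.
am-power-binomial : ∀ k → AbsMonotone (λ t → power k t ℤ.- + (k !) ℤ.* binomial k t)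
am-power-binomial zero    = am-const 0
am-power-binomial (suc k) = am-cong step
  (am-+ (am-id* (am-power-binomial k)) (am-*ˡ k (am-*ˡ (k !) (am-binomial k))))
  where
  falling : ∀ t → + t ℤ.* (+ (k !) ℤ.* binomial k t)
                ≡ + (suc k !) ℤ.* binomial (suc k) t ℤ.+ + k ℤ.* (+ (k !) ℤ.* binomial k t)
  falling t = begin
    + t ℤ.* (+ (k !) ℤ.* + (t choose k))  ≡⟨ cong (+ t ℤ.*_) (sym (ℤ.pos-* (k !) (t choose k))) ⟩
    + t ℤ.* + (k ! ℕ.* (t choose k))      ≡⟨ sym (ℤ.pos-* t _) ⟩
    + (t ℕ.* (k ! ℕ.* (t choose k)))      ≡⟨ cong +_ (n*k!*nCk t k) ⟩
    + (suc k ! ℕ.* (t choose suc k)) ℤ.+ + (k ℕ.* (k ! ℕ.* (t choose k)))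
      ≡⟨ cong₂ ℤ._+_ (ℤ.pos-* (suc k !) (t choose suc k))
           (trans (ℤ.pos-* k _) (cong (+ k ℤ.*_) (ℤ.pos-* (k !) (t choose k)))) ⟩
    + (suc k !) ℤ.* + (t choose suc k) ℤ.+ + k ℤ.* (+ (k !) ℤ.* + (t choose k)) ∎
    where open ≡-Reasoning
  expand : ∀ t p f → t ℤ.* (p ℤ.- f) ≡ t ℤ.* p ℤ.- t ℤ.* f
  expand = ℤ-Ring.solve-∀
  cancel : ∀ tp g h → tp ℤ.- (g ℤ.+ h) ℤ.+ h ≡ tp ℤ.- g
  cancel = ℤ-Ring.solve-∀
  step : ∀ t → + t ℤ.* (power k t ℤ.- + (k !) ℤ.* binomial k t) ℤ.+ + k ℤ.* (+ (k !) ℤ.* binomial k t)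
             ≡ power (suc k) t ℤ.- + (suc k !) ℤ.* binomial (suc k) t
  step t = begin
    + t ℤ.* (power k t ℤ.- b) ℤ.+ + k ℤ.* b          ≡⟨ cong (ℤ._+ + k ℤ.* b) (expand (+ t) (power k t) b) ⟩
    + t ℤ.* power k t ℤ.- + t ℤ.* b ℤ.+ + k ℤ.* b    ≡⟨ cong (λ a → + t ℤ.* power k t ℤ.- a ℤ.+ + k ℤ.* b) (falling t) ⟩
    + t ℤ.* power k t ℤ.- (b′ ℤ.+ + k ℤ.* b) ℤ.+ + k ℤ.* b ≡⟨ cancel (+ t ℤ.* power k t) b′ (+ k ℤ.* b) ⟩
    power (suc k) t ℤ.- b′ ∎
    where
    open ≡-Reasoning
    b  = + (k !) ℤ.* binomial k t
    b′ = + (suc k !) ℤ.* binomial (suc k) t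

-- Smoothing: equal steps are extremal

-- Replacing the steps x and x + d + e by x + d and x + e adds Δ e (Δ d f) at t + x.
Δs-smooth : ∀ {f} → AbsMonotone f → ∀ us x d e t →
  Δs (x ∷ x ℕ.+ d ℕ.+ e ∷ us) f t ℤ.≤ Δs (x ℕ.+ d ∷ x ℕ.+ e ∷ us) f t
Δs-smooth {f} am us x d e t = subst (Δs us F t ℤ.≤_)
  (trans (sym (Δs-+ us _ _ t)) (Δs-cong us identity t))
  (subst (ℤ._≤ Δs us F t ℤ.+ Δs us D t) (ℤ.+-identityʳ _)
    (ℤ.+-monoʳ-≤ (Δs us F t) (am-shift x (am-Δ e (am-Δ d am)) us t)))
  where
  F D G : ℕ → ℤ
  F = Δ (x ℕ.+ d ℕ.+ e) (Δ x f)
  D t = Δ e (Δ d f) (t ℕ.+ x)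
  G = Δ (x ℕ.+ e) (Δ (x ℕ.+ d) f)
  top : ∀ t x d e → t ℕ.+ (x ℕ.+ d ℕ.+ e) ℕ.+ x ≡ t ℕ.+ (x ℕ.+ e) ℕ.+ (x ℕ.+ d)
  top = ℕ-Ring.solve-∀
  far : ∀ t x d e → t ℕ.+ x ℕ.+ e ℕ.+ d ≡ t ℕ.+ (x ℕ.+ d ℕ.+ e)
  far = ℕ-Ring.solve-∀
  regroup : ∀ T L X E D O →
    (T ℤ.- L) ℤ.- (X ℤ.- O) ℤ.+ ((L ℤ.- E) ℤ.- (D ℤ.- X)) ≡ (T ℤ.- E) ℤ.- (D ℤ.- O)
  regroup = ℤ-Ring.solve-∀
  identity : ∀ t → F t ℤ.+ D t ≡ G t
  identity t
    rewrite top t x d e | far t x d e | ℕ.+-assoc t x d | ℕ.+-assoc t x e =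
    regroup (f (t ℕ.+ (x ℕ.+ e) ℕ.+ (x ℕ.+ d))) (f (t ℕ.+ (x ℕ.+ d ℕ.+ e)))
            (f (t ℕ.+ x)) (f (t ℕ.+ (x ℕ.+ e))) (f (t ℕ.+ (x ℕ.+ d))) (f t)

∃-≥average : ∀ s x xs → suc (length xs) ℕ.* s ≤ x ℕ.+ sum xs →
  ∃₂ λ y ys → s ≤ y × x ∷ xs ↭ y ∷ ys
∃-≥average s x xs h with s ℕ.≤? x
... | yes s≤x = x , xs , s≤x , ↭.refl
∃-≥average s x []        h | no s≰x = contradiction
  (ℕ.+-cancelʳ-≤ 0 s x h) s≰x
∃-≥average s x (x′ ∷ xs) h | no s≰x =
  let y , ys , s≤y , p = ∃-≥average s x′ xs
        (ℕ.≮⇒≥ λ lt → ℕ.<⇒≱ (ℕ.+-mono-< (ℕ.≰⇒> s≰x) lt) h)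
  in y , x ∷ ys , s≤y , ↭.trans (↭.prep x p) (↭.swap x y ↭.refl)

∃-≤average : ∀ s x xs → x ℕ.+ sum xs ≤ suc (length xs) ℕ.* s →
  ∃₂ λ y ys → y ≤ s × x ∷ xs ↭ y ∷ ys
∃-≤average s x xs h with x ℕ.≤? s
... | yes x≤s = x , xs , x≤s , ↭.refl
∃-≤average s x []        h | no x≰s = contradiction
  (ℕ.+-cancelʳ-≤ 0 x s h) x≰s
∃-≤average s x (x′ ∷ xs) h | no x≰s =
  let y , ys , y≤s , p = ∃-≤average s x′ xs
        (ℕ.≮⇒≥ λ lt → ℕ.<⇒≱ (ℕ.+-mono-< (ℕ.≰⇒> x≰s) lt) h)
  in y , x ∷ ys , y≤s , ↭.trans (↭.prep x p) (↭.swap x y ↭.refl)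

-- A step on one side of the mean s forces a step on the other side among the rest. The larger one
-- is written `y + d + e` with `y + d` equal to s, so that `Δs-smooth` turns one of the two into
-- exactly s.
straddle : ∀ s x x′ xs → x ℕ.+ (x′ ℕ.+ sum xs) ≡ suc (suc (length xs)) ℕ.* s →
  ∃₂ λ y d → ∃₂ λ e ys → y ℕ.+ d ≡ s × x ∷ x′ ∷ xs ↭ y ∷ y ℕ.+ d ℕ.+ e ∷ ys
straddle s x x′ xs h with ℕ.≤-total x s
... | inj₁ x≤s =
  let y , ys , s≤y , p = ∃-≥average s x′ xs
        (ℕ.≮⇒≥ λ lt → ℕ.<-irrefl h (ℕ.+-mono-≤-< x≤s lt))
      d , s≡x+d = ℕ.m≤n⇒∃[o]m+o≡n x≤s
      e , y≡s+e = ℕ.m≤n⇒∃[o]m+o≡n s≤y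
  in x , d , e , ys , s≡x+d ,
     subst (λ a → x ∷ x′ ∷ xs ↭ x ∷ a ∷ ys)
       (sym (trans (cong (ℕ._+ e) s≡x+d) y≡s+e)) (↭.prep x p)
... | inj₂ s≤x =
  let y , ys , y≤s , p = ∃-≤average s x′ xs
        (ℕ.≮⇒≥ λ lt → ℕ.<-irrefl (sym h) (ℕ.+-mono-≤-< s≤x lt))
      d , s≡y+d = ℕ.m≤n⇒∃[o]m+o≡n y≤s
      e , x≡s+e = ℕ.m≤n⇒∃[o]m+o≡n s≤x
  in y , d , e , ys , s≡y+d ,
     subst (λ a → x ∷ x′ ∷ xs ↭ y ∷ a ∷ ys)
       (sym (trans (cong (ℕ._+ e) s≡y+d) x≡s+e)) (↭.trans (↭.prep x p) (↭.swap x y ↭.refl))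

-- Each smoothing fixes one step at the mean s. That step is absorbed into the function, since
-- `Δ s f` is again absolutely monotone, and the remaining steps still have mean s, so the induction
-- is on their number.
Δs-≤-average : ∀ m s {f} → AbsMonotone f → ∀ xs → length xs ≡ m → sum xs ≡ m ℕ.* s →
  ∀ t → Δs xs f t ℤ.≤ Δs (replicate m s) f t
Δs-≤-average zero s am [] _ _ t = ℤ.≤-refl
Δs-≤-average (suc m) s {f} am (x ∷ []) refl h t =
  ℤ.≤-reflexive (cong (λ a → Δs (a ∷ []) f t) (ℕ.+-cancelʳ-≡ 0 x s h))
Δs-≤-average (suc m) s {f} am (x ∷ x′ ∷ xs) len h t
  with y , d , e , ys , refl , p ← straddle s x x′ xs
         (trans h (cong (ℕ._* s) (sym len))) = begin
  Δs (x ∷ x′ ∷ xs) f t                 ≡⟨ Δs-↭ p f t ⟩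
  Δs (y ∷ y ℕ.+ d ℕ.+ e ∷ ys) f t      ≤⟨ Δs-smooth am ys y d e t ⟩
  Δs (s ∷ y ℕ.+ e ∷ ys) f t            ≤⟨ Δs-≤-average m s (am-Δ s am) (y ℕ.+ e ∷ ys)
                                            (ℕ.suc-injective (trans (sym (↭-length p)) len)) sum′ t ⟩
  Δs (replicate (suc m) s) f t         ∎
  where
  open ℤ.≤-Reasoning
  rotate : ∀ y d e t → y ℕ.+ d ℕ.+ (y ℕ.+ e ℕ.+ t) ≡ y ℕ.+ (y ℕ.+ d ℕ.+ e ℕ.+ t)
  rotate = ℕ-Ring.solve-∀
  sum′ : y ℕ.+ e ℕ.+ sum ys ≡ m ℕ.* s
  sum′ = ℕ.+-cancelˡ-≡ s _ _
    (trans (rotate y d e (sum ys)) (trans (sym (sum-↭ p)) h))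

-- Unit differences of powers and Stirling numbers

-- The iterated Leibniz rule for unit steps. At t = 0 with f a power, both coefficients equal m + 1,
-- which is the Stirling recurrence after multiplication by (m + 1)!.
Δs-1-id* : ∀ m f t → Δs (replicate (suc m) 1) (λ t → + t ℤ.* f t) t
  ≡ + (t ℕ.+ suc m) ℤ.* Δs (replicate (suc m) 1) f t ℤ.+ + suc m ℤ.* Δs (replicate m 1) f t
Δs-1-id* zero f t = expand (+ t) (f (t ℕ.+ 1)) (f t)
  where
  expand : ∀ t a b → (t ℤ.+ 1ℤ) ℤ.* a ℤ.- t ℤ.* b ≡ (t ℤ.+ 1ℤ) ℤ.* (a ℤ.- b) ℤ.+ 1ℤ ℤ.* b
  expand = ℤ-Ring.solve-∀
Δs-1-id* (suc m) f t = begin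
  Δs us (Δ 1 (λ t → + t ℤ.* f t)) t
    ≡⟨ Δs-cong us (λ t → expand (+ t) (f (t ℕ.+ 1)) (f t)) t ⟩
  Δs us (λ t → + t ℤ.* Δ 1 f t ℤ.+ f (t ℕ.+ 1)) t
    ≡⟨ trans (Δs-+ us (λ t → + t ℤ.* Δ 1 f t) (λ t → f (t ℕ.+ 1)) t) (cong₂ ℤ._+_ (Δs-1-id* m (Δ 1 f) t) (Δs-shift us 1 f t)) ⟩
  (+ t ℤ.+ + suc m) ℤ.* X ℤ.+ + suc m ℤ.* Δs us f t ℤ.+ Δs us f (t ℕ.+ 1)
    ≡⟨ cong (λ a → (+ t ℤ.+ + suc m) ℤ.* X ℤ.+ + suc m ℤ.* Δs us f t ℤ.+ a) (split (Δs us f (t ℕ.+ 1)) (Δs us f t)) ⟩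
  (+ t ℤ.+ + suc m) ℤ.* X ℤ.+ + suc m ℤ.* Δs us f t ℤ.+ (Δs us f (t ℕ.+ 1) ℤ.- Δs us f t ℤ.+ Δs us f t)
    ≡⟨ cong (λ a → (+ t ℤ.+ + suc m) ℤ.* X ℤ.+ + suc m ℤ.* Δs us f t ℤ.+ (a ℤ.+ Δs us f t)) (sym (Δs-Δ us 1 f t)) ⟩
  (+ t ℤ.+ + suc m) ℤ.* X ℤ.+ + suc m ℤ.* Δs us f t ℤ.+ (X ℤ.+ Δs us f t)
    ≡⟨ collect (+ t) (+ suc m) X (Δs us f t) ⟩
  (+ t ℤ.+ (1ℤ ℤ.+ + suc m)) ℤ.* X ℤ.+ (1ℤ ℤ.+ + suc m) ℤ.* Δs us f t ∎
  where
  open ≡-Reasoning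
  us = replicate (suc m) 1
  X = Δs us (Δ 1 f) t
  expand : ∀ t a b → (t ℤ.+ 1ℤ) ℤ.* a ℤ.- t ℤ.* b ≡ t ℤ.* (a ℤ.- b) ℤ.+ a
  expand = ℤ-Ring.solve-∀
  split : ∀ a b → a ≡ a ℤ.- b ℤ.+ b
  split = ℤ-Ring.solve-∀
  collect : ∀ t m x y → (t ℤ.+ m) ℤ.* x ℤ.+ m ℤ.* y ℤ.+ (x ℤ.+ y) ≡ (t ℤ.+ (1ℤ ℤ.+ m)) ℤ.* x ℤ.+ (1ℤ ℤ.+ m) ℤ.* y
  collect = ℤ-Ring.solve-∀

Δs-const : ∀ us u c t → Δs (u ∷ us) (const c) t ≡ 0ℤ
Δs-const []       u c t = ℤ.+-inverseʳ c
Δs-const (v ∷ us) u c t = trans (Δs-cong us (λ _ → cong (ℤ._- (c ℤ.- c)) (ℤ.+-inverseʳ c)) t)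
  (trans (Δs-cong us (λ _ → trans (ℤ.+-identityˡ _) (cong ℤ.-_ (ℤ.+-inverseʳ c))) t) (Δs-zero us t))
  where
  Δs-zero : ∀ us t → Δs us (const 0ℤ) t ≡ 0ℤ
  Δs-zero []       t = refl
  Δs-zero (u ∷ us) t = Δs-zero us t

-- Both sides count the surjections from a k-set onto an r-set.
Δs-1-power : ∀ k r → Δs (replicate r 1) (power k) 0 ≡ + (stirling2 k r ℕ.* r !)
Δs-1-power zero    zero    = refl
Δs-1-power zero    (suc r) = Δs-const (replicate r 1) 1 1ℤ 0
Δs-1-power (suc k) zero    = refl
Δs-1-power (suc k) (suc r) = begin
  Δs (replicate (suc r) 1) (power (suc k)) 0
    ≡⟨ Δs-1-id* r (power k) 0 ⟩
  + suc r ℤ.* Δs (replicate (suc r) 1) (power k) 0 ℤ.+ + suc r ℤ.* Δs (replicate r 1) (power k) 0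
    ≡⟨ cong₂ (λ a b → + suc r ℤ.* a ℤ.+ + suc r ℤ.* b) (Δs-1-power k (suc r)) (Δs-1-power k r) ⟩
  + suc r ℤ.* + (stirling2 k (suc r) ℕ.* suc r !) ℤ.+ + suc r ℤ.* + (stirling2 k r ℕ.* r !)
    ≡⟨ cong₂ ℤ._+_ (sym (ℤ.pos-* (suc r) (stirling2 k (suc r) ℕ.* suc r !))) (sym (ℤ.pos-* (suc r) (stirling2 k r ℕ.* r !))) ⟩
  + (suc r ℕ.* (stirling2 k (suc r) ℕ.* suc r !) ℕ.+ suc r ℕ.* (stirling2 k r ℕ.* r !))
    ≡⟨ cong +_ (collect r (stirling2 k (suc r)) (stirling2 k r) (r !)) ⟩
  + (stirling2 (suc k) (suc r) ℕ.* suc r !) ∎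
  where
  open ≡-Reasoning
  collect : ∀ r a b f → suc r ℕ.* (a ℕ.* (suc r ℕ.* f)) ℕ.+ suc r ℕ.* (b ℕ.* f)
    ≡ (suc r ℕ.* a ℕ.+ b) ℕ.* (suc r ℕ.* f)
  collect = ℕ-Ring.solve-∀

Δs-scale-power : ∀ k c xs t → Δs (map (c ℕ.*_) xs) (power k) (c ℕ.* t) ≡ power k c ℤ.* Δs xs (power k) t
Δs-scale-power k c xs t = trans (Δs-scale xs c (power k) t)
  (trans (Δs-cong xs (λ t → power-* k c t) t) (Δs-*ˡ xs (power k c) (power k) t))
  where
  power-* : ∀ k c t → power k (c ℕ.* t) ≡ power k c ℤ.* power k t
  power-* zero    c t = refl
  power-* (suc k) c t = trans (cong₂ ℤ._*_ (ℤ.pos-* c t) (power-* k c t))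
    (interchange (+ c) (+ t) (power k c) (power k t))
    where
    interchange : ∀ a b c d → (a ℤ.* b) ℤ.* (c ℤ.* d) ≡ (a ℤ.* c) ℤ.* (b ℤ.* d)
    interchange = ℤ-Ring.solve-∀

power-pos : ∀ k n → power k n ≡ + (n ℕ.^ k)
power-pos zero    n = refl
power-pos (suc k) n = trans (cong (+ n ℤ.*_) (power-pos k n)) (sym (ℤ.pos-* n (n ℕ.^ k)))

-- Scaling the steps by r makes their average, sum xs, an integer.
Δs-binomial-bound : ∀ k r xs → length xs ≡ r →
  + (r ℕ.^ k ℕ.* k !) ℤ.* Δs xs (binomial k) 0 ℤ.≤ + (stirling2 k r ℕ.* r ! ℕ.* sum xs ℕ.^ k)
Δs-binomial-bound k r xs len = begin
  + (r ℕ.^ k ℕ.* k !) ℤ.* Δs xs (binomial k) 0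
    ≡⟨ cong (ℤ._* Δs xs (binomial k) 0) (ℤ.pos-* (r ℕ.^ k) (k !)) ⟩
  + (r ℕ.^ k) ℤ.* + (k !) ℤ.* Δs xs (binomial k) 0
    ≡⟨ ℤ.*-assoc (+ (r ℕ.^ k)) (+ (k !)) _ ⟩
  + (r ℕ.^ k) ℤ.* (+ (k !) ℤ.* Δs xs (binomial k) 0)
    ≤⟨ ℤ.*-monoˡ-≤-nonNeg (+ (r ℕ.^ k)) power-dominates ⟩
  + (r ℕ.^ k) ℤ.* Δs xs (power k) 0
    ≡⟨ cong (ℤ._* Δs xs (power k) 0) (sym (power-pos k r)) ⟩
  power k r ℤ.* Δs xs (power k) 0
    ≡⟨ sym (Δs-scale-power k r xs 0) ⟩
  Δs (map (r ℕ.*_) xs) (power k) (r ℕ.* 0)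
    ≡⟨ cong (Δs (map (r ℕ.*_) xs) (power k)) (ℕ.*-zeroʳ r) ⟩
  Δs (map (r ℕ.*_) xs) (power k) 0
    ≤⟨ Δs-≤-average r (sum xs) (am-power k) (map (r ℕ.*_) xs)
         (trans (length-map _ xs) len) (sum-map-* r xs) 0 ⟩
  Δs (replicate r (sum xs)) (power k) 0
    ≡⟨ cong₂ (λ ys t → Δs ys (power k) t) replicate-sum (sym (ℕ.*-zeroʳ (sum xs))) ⟩
  Δs (map (sum xs ℕ.*_) (replicate r 1)) (power k) (sum xs ℕ.* 0)
    ≡⟨ Δs-scale-power k (sum xs) (replicate r 1) 0 ⟩
  power k (sum xs) ℤ.* Δs (replicate r 1) (power k) 0
    ≡⟨ cong₂ ℤ._*_ (power-pos k (sum xs)) (Δs-1-power k r) ⟩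
  + (sum xs ℕ.^ k) ℤ.* + (stirling2 k r ℕ.* r !)
    ≡⟨ trans (sym (ℤ.pos-* (sum xs ℕ.^ k) _)) (cong +_ (ℕ.*-comm (sum xs ℕ.^ k) _)) ⟩
  + (stirling2 k r ℕ.* r ! ℕ.* sum xs ℕ.^ k) ∎
  where
  open ℤ.≤-Reasoning
  sum-map-* : ∀ c xs → sum (map (c ℕ.*_) xs) ≡ c ℕ.* sum xs
  sum-map-* c []       = sym (ℕ.*-zeroʳ c)
  sum-map-* c (x ∷ xs) = trans (cong (c ℕ.* x ℕ.+_) (sum-map-* c xs)) (sym (ℕ.*-distribˡ-+ c x (sum xs)))
  replicate-sum : replicate r (sum xs) ≡ map (sum xs ℕ.*_) (replicate r 1)
  replicate-sum = sym (trans (map-replicate (sum xs ℕ.*_) r 1) (cong (replicate r) (ℕ.*-identityʳ (sum xs))))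
  split : ∀ a b → a ≡ b ℤ.+ (a ℤ.- b)
  split = ℤ-Ring.solve-∀
  power-dominates : + (k !) ℤ.* Δs xs (binomial k) 0 ℤ.≤ Δs xs (power k) 0
  power-dominates = begin
    + (k !) ℤ.* Δs xs (binomial k) 0
      ≡⟨ sym (Δs-*ˡ xs (+ (k !)) (binomial k) 0) ⟩
    Δs xs (λ t → + (k !) ℤ.* binomial k t) 0
      ≡⟨ sym (ℤ.+-identityʳ _) ⟩
    Δs xs (λ t → + (k !) ℤ.* binomial k t) 0 ℤ.+ 0ℤ
      ≤⟨ ℤ.+-monoʳ-≤ (Δs xs (λ t → + (k !) ℤ.* binomial k t) 0) (am-power-binomial k xs 0) ⟩
    Δs xs (λ t → + (k !) ℤ.* binomial k t) 0 ℤ.+ Δs xs (λ t → power k t ℤ.- + (k !) ℤ.* binomial k t) 0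
      ≡⟨ sym (Δs-+ xs _ _ 0) ⟩
    Δs xs (λ t → + (k !) ℤ.* binomial k t ℤ.+ (power k t ℤ.- + (k !) ℤ.* binomial k t)) 0
      ≡⟨ Δs-cong xs (λ t → sym (split (power k t) (+ (k !) ℤ.* binomial k t))) 0 ⟩
    Δs xs (power k) 0 ∎

-- Counting the k-sets that meet every part

𝟙 : Bool → ℕ
𝟙 true  = 1
𝟙 false = 0

tally : {A : Set} → (A → Bool) → List A → ℕ
tally b []       = 0
tally b (x ∷ xs) = 𝟙 (b x) ℕ.+ tally b xs

tally-cong : {A : Set} {f g : A → Bool} → (∀ x → f x ≡ g x) → ∀ xs → tally f xs ≡ tally g xs
tally-cong f≗g []       = refl
tally-cong f≗g (x ∷ xs) = cong₂ ℕ._+_ (cong 𝟙 (f≗g x)) (tally-cong f≗g xs)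

tally-false : {A : Set} {f : A → Bool} → (∀ x → f x ≡ false) → ∀ xs → tally f xs ≡ 0
tally-false f≗false []       = refl
tally-false f≗false (x ∷ xs) = cong₂ ℕ._+_ (cong 𝟙 (f≗false x)) (tally-false f≗false xs)

tally-++ : {A : Set} (f : A → Bool) → ∀ xs ys → tally f (xs ++ ys) ≡ tally f xs ℕ.+ tally f ys
tally-++ f []       ys = refl
tally-++ f (x ∷ xs) ys = trans (cong (𝟙 (f x) ℕ.+_) (tally-++ f xs ys))
  (sym (ℕ.+-assoc (𝟙 (f x)) (tally f xs) (tally f ys)))

tally-map : {A B : Set} (f : B → Bool) (g : A → B) → ∀ xs → tally f (map g xs) ≡ tally (f ∘ g) xs
tally-map f g []       = refl
tally-map f g (x ∷ xs) = cong (𝟙 (f (g x)) ℕ.+_) (tally-map f g xs)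

tally-+ : {A : Set} {f g h : A → Bool} → (∀ x → 𝟙 (f x) ℕ.+ 𝟙 (g x) ≡ 𝟙 (h x)) →
  ∀ xs → tally f xs ℕ.+ tally g xs ≡ tally h xs
tally-+ f+g≗h []       = refl
tally-+ {f = f} {g} f+g≗h (x ∷ xs) = trans
  (interchange (𝟙 (f x)) (tally f xs) (𝟙 (g x)) (tally g xs))
  (cong₂ ℕ._+_ (f+g≗h x) (tally-+ f+g≗h xs))
  where
  interchange : ∀ a b c d → (a ℕ.+ b) ℕ.+ (c ℕ.+ d) ≡ (a ℕ.+ c) ℕ.+ (b ℕ.+ d)
  interchange = ℕ-Ring.solve-∀

length-filter : {A : Set} {P : Pred A 0ℓ} (P? : Decidable P) → ∀ xs →
  length (filter P? xs) ≡ tally (does ∘ P?) xs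
length-filter P? []       = refl
length-filter P? (x ∷ xs) with does (P? x)
... | true  = cong suc (length-filter P? xs)
... | false = length-filter P? xs

tally-filter : {A : Set} {P : Pred A 0ℓ} (P? : Decidable P) (b : A → Bool) → ∀ xs →
  tally b (filter P? xs) ≡ tally (λ x → does (P? x) ∧ b x) xs
tally-filter P? b []       = refl
tally-filter P? b (x ∷ xs) with does (P? x)
... | true  = cong (𝟙 (b x) ℕ.+_) (tally-filter P? b xs)
... | false = tally-filter P? b xs

length-filter-true : {A : Set} (b : A → Bool) → ∀ xs →
  length (filter (λ x → b x Bool.≟ true) xs) ≡ tally b xs
length-filter-true b xs = trans (length-filter (λ x → b x Bool.≟ true) xs) (tally-cong (does-true ∘ b) xs)
  where
  does-true : ∀ x → does (x Bool.≟ true) ≡ x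
  does-true true  = refl
  does-true false = refl

≡ᶠ-refl : ∀ {r} (i : Fin r) → (i ≡ᶠ i) ≡ true
≡ᶠ-refl i = Bool.T-≡ .Equivalence.to (ℕ.≡⇒≡ᵇ (Fin.toℕ i) (Fin.toℕ i) refl)

≢⇒≡ᶠ-false : ∀ {r} {i j : Fin r} → i ≢ j → (i ≡ᶠ j) ≡ false
≢⇒≡ᶠ-false {i = i} {j} i≢j = Bool.¬-not
  λ eq → i≢j (Fin.toℕ-injective (ℕ.≡ᵇ⇒≡ (Fin.toℕ i) (Fin.toℕ j) (subst T (sym eq) _)))

avoid : ∀ {n r} → (Fin r → Bool) → Subset n → Cut n r → Bool
avoid B []      []      = true
avoid B (x ∷ e) (i ∷ c) = not (x ∧ B i) ∧ avoid B e c

hit : ∀ {n r} → Fin r → Subset n → Cut n r → Bool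
hit j []      []      = false
hit j (x ∷ e) (i ∷ c) = (x ∧ (i ≡ᶠ j)) ∨ hit j e c

free : ∀ {n r} → (Fin r → Bool) → Cut n r → ℕ
free B []      = 0
free B (i ∷ c) = 𝟙 (not (B i)) ℕ.+ free B c

partSize : ∀ {n r} → Cut n r → Fin r → ℕ
partSize c j = free (λ i → not (i ≡ᶠ j)) c

infixl 6 _∪_
_∪_ : ∀ {r} → (Fin r → Bool) → Fin r → Fin r → Bool
(B ∪ j) i = (i ≡ᶠ j) ∨ B i

_∪*_ : ∀ {r} → (Fin r → Bool) → List (Fin r) → Fin r → Bool
B ∪* []      = B
B ∪* (j ∷ L) = (B ∪ j) ∪* L

∪*-∪ : ∀ {r} (B : Fin r → Bool) j L i → ((B ∪ j) ∪* L) i ≡ ((B ∪* L) ∪ j) i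
∪*-∪ B j []       i = refl
∪*-∪ B j (j′ ∷ L) i = trans (∪*-cong (λ i → ∨-left-comm (i ≡ᶠ j′) (i ≡ᶠ j) (B i)) L i)
  (∪*-∪ (B ∪ j′) j L i)
  where
  ∨-left-comm : ∀ a b c → a ∨ (b ∨ c) ≡ b ∨ (a ∨ c)
  ∨-left-comm false b     c = refl
  ∨-left-comm true  false c = refl
  ∨-left-comm true  true  c = refl
  ∪*-cong : ∀ {B B′} → (∀ i → B i ≡ B′ i) → ∀ L i → (B ∪* L) i ≡ (B′ ∪* L) i
  ∪*-cong eq []      i = eq i
  ∪*-cong eq (l ∷ L) i = ∪*-cong (λ i → cong ((i ≡ᶠ l) ∨_) (eq i)) L i

∉-∪* : ∀ {r} {B : Fin r → Bool} {j} L → B j ≡ false → All (j ≢_) L → (B ∪* L) j ≡ false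
∉-∪* []       j∉B []          = j∉B
∉-∪* (j′ ∷ L) j∉B (j≢j′ ∷ j∉L) = ∉-∪* L (cong₂ _∨_ (≢⇒≡ᶠ-false j≢j′) j∉B) j∉L

∈-∪* : ∀ {r} (B : Fin r → Bool) {i} {L} → i ∈ L → (B ∪* L) i ≡ true
∈-∪* B {i} {j ∷ L} (here refl) = trans (∪*-∪ B i L i) (cong (_∨ (B ∪* L) i) (≡ᶠ-refl i))
∈-∪* B {i} {j ∷ L} (there i∈L) = ∈-∪* (B ∪ j) i∈L

free-cong : ∀ {n r} {B B′ : Fin r → Bool} → (∀ i → B i ≡ B′ i) → (c : Cut n r) → free B c ≡ free B′ c
free-cong eq []      = refl
free-cong eq (i ∷ c) = cong₂ ℕ._+_ (cong (𝟙 ∘ not) (eq i)) (free-cong eq c)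

free-∪ : ∀ {n r} {B : Fin r → Bool} {j} → B j ≡ false → (c : Cut n r) →
  free B c ≡ free (B ∪ j) c ℕ.+ partSize c j
free-∪ j∉B []      = refl
free-∪ {B = B} {j} j∉B (i ∷ c) = trans (cong₂ ℕ._+_ head (free-∪ j∉B c))
  (interchange (𝟙 (not ((B ∪ j) i))) (𝟙 (not (not (i ≡ᶠ j)))) (free (B ∪ j) c) (partSize c j))
  where
  interchange : ∀ a b c d → (a ℕ.+ b) ℕ.+ (c ℕ.+ d) ≡ (a ℕ.+ c) ℕ.+ (b ℕ.+ d)
  interchange = ℕ-Ring.solve-∀
  head : 𝟙 (not (B i)) ≡ 𝟙 (not ((B ∪ j) i)) ℕ.+ 𝟙 (not (not (i ≡ᶠ j)))
  head with i Fin.≟ j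
  ... | yes refl rewrite ≡ᶠ-refl i | j∉B = refl
  ... | no i≢j  rewrite ≢⇒≡ᶠ-false i≢j = sym (ℕ.+-identityʳ _)

free-∪* : ∀ {n r} {B : Fin r → Bool} {L} → Unique L → All (λ j → B j ≡ false) L → (c : Cut n r) →
  free B c ≡ free (B ∪* L) c ℕ.+ sum (map (partSize c) L)
free-∪* {L = []}    []         []           c = sym (ℕ.+-identityʳ _)
free-∪* {B = B} {j ∷ L} (j∉L ∷ uniq) (j∉B ∷ L∉B) c = begin
  free B c                                                   ≡⟨ free-∪* uniq L∉B c ⟩
  free (B ∪* L) c ℕ.+ S                                      ≡⟨ cong (ℕ._+ S) (free-∪ (∉-∪* L j∉B j∉L) c) ⟩
  free ((B ∪* L) ∪ j) c ℕ.+ partSize c j ℕ.+ S               ≡⟨ cong (λ a → a ℕ.+ partSize c j ℕ.+ S) (free-cong (sym ∘ ∪*-∪ B j L) c) ⟩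
  free (B ∪* (j ∷ L)) c ℕ.+ partSize c j ℕ.+ S               ≡⟨ ℕ.+-assoc (free (B ∪* (j ∷ L)) c) (partSize c j) S ⟩
  free (B ∪* (j ∷ L)) c ℕ.+ sum (map (partSize c) (j ∷ L))   ∎
  where
  open ≡-Reasoning
  S = sum (map (partSize c) L)

tally-allSubsets : ∀ n (f : Subset (suc n) → Bool) →
  tally f (allSubsets (suc n)) ≡ tally (f ∘ (true ∷_)) (allSubsets n) ℕ.+ tally (f ∘ (false ∷_)) (allSubsets n)
tally-allSubsets n f = trans (tally-++ f (map (true ∷_) (allSubsets n)) _) (cong₂ ℕ._+_
  (tally-map f (true ∷_) (allSubsets n))
  (trans (cong (tally f) (++-identityʳ (map (false ∷_) (allSubsets n)))) (tally-map f (false ∷_) (allSubsets n))))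

-- The sets counted are the k-subsets of the free vertices. Deciding the vertices one at a time, a
-- free vertex gives Pascal's rule and a blocked one can only be left out.
tally-avoid : ∀ k {n r} (B : Fin r → Bool) (c : Cut n r) →
  tally (λ e → (∣ e ∣ ℕ.≡ᵇ k) ∧ avoid B e c) (allSubsets n) ≡ free B c choose k
tally-avoid zero    B [] = refl
tally-avoid (suc k) B [] = refl
tally-avoid k {suc n} B (i ∷ c) = trans (tally-allSubsets n _) (step k (B i))
  where
  open ≡-Reasoning
  IH = λ k → tally-avoid k B c
  step : ∀ k b →
    tally (λ e → (suc ∣ e ∣ ℕ.≡ᵇ k) ∧ (not b ∧ avoid B e c)) (allSubsets n)
      ℕ.+ tally (λ e → (∣ e ∣ ℕ.≡ᵇ k) ∧ avoid B e c) (allSubsets n)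
    ≡ (𝟙 (not b) ℕ.+ free B c) choose k
  step zero    b     = cong₂ ℕ._+_ (tally-false (λ e → refl) (allSubsets n)) (IH 0)
  step (suc k) true  = cong₂ ℕ._+_
    (tally-false (λ e → Bool.∧-zeroʳ (∣ e ∣ ℕ.≡ᵇ k)) (allSubsets n)) (IH (suc k))
  step (suc k) false = trans (cong₂ ℕ._+_ (IH k) (IH (suc k))) (nCk+nC[k+1]≡[n+1]C[k+1] (free B c) k)

avoid-∪ : ∀ {n r} (B : Fin r → Bool) j (e : Subset n) (c : Cut n r) →
  avoid (B ∪ j) e c ≡ avoid B e c ∧ not (hit j e c)
avoid-∪ B j []      []      = refl
avoid-∪ B j (x ∷ e) (i ∷ c) = trans (cong (not (x ∧ ((i ≡ᶠ j) ∨ B i)) ∧_) (avoid-∪ B j e c))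
  (rearrange x (i ≡ᶠ j) (B i) (avoid B e c) (hit j e c))
  where
  rearrange : ∀ x d b a h → not (x ∧ (d ∨ b)) ∧ (a ∧ not h) ≡ (not (x ∧ b) ∧ a) ∧ not ((x ∧ d) ∨ h)
  rearrange false d     b     a     h = refl
  rearrange true  false b     a     h = sym (Bool.∧-assoc (not b) a (not h))
  rearrange true  true  b     a     h = sym (Bool.∧-zeroʳ (not b ∧ a))

-- Inclusion-exclusion: sets meeting part j = all sets − sets avoiding part j.
tally-hits : ∀ k {n r} (c : Cut n r) (B : Fin r → Bool) L → Unique L → All (λ j → B j ≡ false) L →
  + tally (λ e → (∣ e ∣ ℕ.≡ᵇ k) ∧ (avoid B e c ∧ all (λ j → hit j e c) L)) (allSubsets n)
  ≡ Δs (map (partSize c) L) (binomial k) (free (B ∪* L) c)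
tally-hits k {n} c B [] _ _ = cong +_
  (trans (tally-cong (λ e → cong ((∣ e ∣ ℕ.≡ᵇ k) ∧_) (Bool.∧-identityʳ _)) (allSubsets n)) (tally-avoid k B c))
tally-hits k {n} c B (j ∷ L) (j∉L ∷ uniq) (j∉B ∷ L∉B) = begin
  + X                                   ≡⟨ difference (+ X) (+ Y) ⟩
  + (X ℕ.+ Y) ℤ.- + Y                   ≡⟨ cong (λ a → + a ℤ.- + Y) X+Y≡Z ⟩
  + Z ℤ.- + Y                           ≡⟨ cong₂ ℤ._-_ (tally-hits k c B L uniq L∉B)
                                             (tally-hits k c (B ∪ j) L uniq L∉B∪j) ⟩
  Δs us (binomial k) (free (B ∪* L) c) ℤ.- Δs us (binomial k) (free (B ∪* (j ∷ L)) c)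
    -- Blocking part j lowers the number of free vertices by the size of that part, so the two
    -- inductive values differ only in the base point and their difference is one more step of `Δs`.
    ≡⟨ cong (λ a → Δs us (binomial k) a ℤ.- Δs us (binomial k) (free (B ∪* (j ∷ L)) c))
         (trans (free-∪ (∉-∪* L j∉B j∉L) c) (cong (ℕ._+ partSize c j) (free-cong (sym ∘ ∪*-∪ B j L) c))) ⟩
  Δs us (binomial k) (free (B ∪* (j ∷ L)) c ℕ.+ partSize c j) ℤ.- Δs us (binomial k) (free (B ∪* (j ∷ L)) c)
    ≡⟨ sym (Δs-Δ us (partSize c j) (binomial k) (free (B ∪* (j ∷ L)) c)) ⟩
  Δs (partSize c j ∷ us) (binomial k) (free (B ∪* (j ∷ L)) c) ∎
  where
  open ≡-Reasoning
  us = map (partSize c) L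
  hits = λ e → all (λ j → hit j e c) L
  X = tally (λ e → (∣ e ∣ ℕ.≡ᵇ k) ∧ (avoid B e c ∧ (hit j e c ∧ hits e))) (allSubsets n)
  Y = tally (λ e → (∣ e ∣ ℕ.≡ᵇ k) ∧ (avoid (B ∪ j) e c ∧ hits e)) (allSubsets n)
  Z = tally (λ e → (∣ e ∣ ℕ.≡ᵇ k) ∧ (avoid B e c ∧ hits e)) (allSubsets n)
  difference : ∀ x y → x ≡ x ℤ.+ y ℤ.- y
  difference = ℤ-Ring.solve-∀
  split : ∀ a v h w → 𝟙 (a ∧ (v ∧ (h ∧ w))) ℕ.+ 𝟙 (a ∧ ((v ∧ not h) ∧ w)) ≡ 𝟙 (a ∧ (v ∧ w))
  split false v     h     w = refl
  split true  false h     w = refl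
  split true  true  false w = refl
  split true  true  true  w = ℕ.+-identityʳ _
  X+Y≡Z : X ℕ.+ Y ≡ Z
  X+Y≡Z = tally-+ (λ e → trans
    (cong (λ a → 𝟙 ((∣ e ∣ ℕ.≡ᵇ k) ∧ (avoid B e c ∧ (hit j e c ∧ hits e))) ℕ.+ 𝟙 ((∣ e ∣ ℕ.≡ᵇ k) ∧ (a ∧ hits e)))
      (avoid-∪ B j e c))
    (split (∣ e ∣ ℕ.≡ᵇ k) (avoid B e c) (hit j e c) (hits e))) (allSubsets n)
  L∉B∪j : All (λ i → (B ∪ j) i ≡ false) L
  L∉B∪j = All.zipWith (λ (j≢i , i∉B) → cong₂ _∨_ (≢⇒≡ᶠ-false (j≢i ∘ sym)) i∉B) (j∉L , L∉B)

-- `allFin n` is a tabulation whose index function changes at each vertex, so the induction runs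
-- over an arbitrary g.
any-hit : ∀ {m n r} j (e : Subset n) (c : Cut n r) (f : Fin m → Bool) (g : Fin n → Fin m) →
  (∀ v → f (g v) ≡ lookup e v ∧ (lookup c v ≡ᶠ j)) → any f (tabulate g) ≡ hit j e c
any-hit j []      []      f g eq = refl
any-hit j (x ∷ e) (i ∷ c) f g eq =
  cong₂ _∨_ (eq Fin.zero) (any-hit j e c f (g ∘ Fin.suc) (eq ∘ Fin.suc))

all-cong : {A : Set} {f g : A → Bool} → (∀ x → f x ≡ g x) → ∀ xs → all f xs ≡ all g xs
all-cong f≗g []       = refl
all-cong f≗g (x ∷ xs) = cong₂ _∧_ (f≗g x) (all-cong f≗g xs)

crosses-hit : ∀ {n r} (c : Cut n r) e → crosses c e ≡ all (λ j → hit j e c) (allFin r)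
crosses-hit {r = r} c e = all-cong (λ j → any-hit j e c _ id (λ _ → refl)) (allFin r)

avoid-none : ∀ {n r} (e : Subset n) (c : Cut n r) → avoid (const false) e c ≡ true
avoid-none []      []      = refl
avoid-none (x ∷ e) (i ∷ c) = trans (cong (λ b → not b ∧ avoid (const false) e c) (Bool.∧-zeroʳ x)) (avoid-none e c)

free-none : ∀ {n r} (c : Cut n r) → free (const false) c ≡ n
free-none []      = refl
free-none (i ∷ c) = cong suc (free-none c)

free-all : ∀ {n r} {B : Fin r → Bool} → (∀ i → B i ≡ true) → (c : Cut n r) → free B c ≡ 0
free-all eq []      = refl
free-all eq (i ∷ c) = cong₂ ℕ._+_ (cong (𝟙 ∘ not) (eq i)) (free-all eq c)

-- The base point is 0 because no vertex stays free once all parts are blocked.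
tally-crosses : ∀ k {n r} (c : Cut n r) →
  + tally (crosses c) (kSets n k) ≡ Δs (map (partSize c) (allFin r)) (binomial k) 0
tally-crosses k {n} {r} c = begin
  + tally (crosses c) (kSets n k)
    ≡⟨ cong +_ (tally-filter (λ e → ∣ e ∣ ℕ.≟ k) (crosses c) (allSubsets n)) ⟩
  + tally (λ e → (∣ e ∣ ℕ.≡ᵇ k) ∧ crosses c e) (allSubsets n)
    ≡⟨ cong +_ (tally-cong (λ e → cong ((∣ e ∣ ℕ.≡ᵇ k) ∧_)
         (cong₂ _∧_ (sym (avoid-none e c)) (crosses-hit c e))) (allSubsets n)) ⟩
  + tally (λ e → (∣ e ∣ ℕ.≡ᵇ k) ∧ (avoid (const false) e c ∧ all (λ j → hit j e c) (allFin r))) (allSubsets n)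
    ≡⟨ tally-hits k c (const false) (allFin r) (allFin⁺ r) (All.tabulate (λ _ → refl)) ⟩
  Δs (map (partSize c) (allFin r)) (binomial k) (free (const false ∪* allFin r) c)
    ≡⟨ cong (Δs (map (partSize c) (allFin r)) (binomial k)) (free-all (λ i → ∈-∪* (const false) (∈-allFin i)) c) ⟩
  Δs (map (partSize c) (allFin r)) (binomial k) 0 ∎
  where open ≡-Reasoning

sum-partSize : ∀ {n r} (c : Cut n r) → sum (map (partSize c) (allFin r)) ≡ n
sum-partSize {n} {r} c = begin
  sum (map (partSize c) (allFin r))
    ≡⟨ cong (ℕ._+ sum (map (partSize c) (allFin r))) (sym (free-all (λ i → ∈-∪* (const false) (∈-allFin i)) c)) ⟩
  free (const false ∪* allFin r) c ℕ.+ sum (map (partSize c) (allFin r))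
    ≡⟨ sym (free-∪* (allFin⁺ r) (All.tabulate (λ _ → refl)) c) ⟩
  free (const false) c
    ≡⟨ free-none c ⟩
  n ∎
  where open ≡-Reasoning

crosses-bound : ∀ k {n r} (c : Cut n r) →
  r ℕ.^ k ℕ.* k ! ℕ.* tally (crosses c) (kSets n k) ≤ stirling2 k r ℕ.* r ! ℕ.* n ℕ.^ k
crosses-bound k {n} {r} c = ℤ.drop‿+≤+ (begin
  + (r ℕ.^ k ℕ.* k ! ℕ.* tally (crosses c) (kSets n k))
    ≡⟨ ℤ.pos-* (r ℕ.^ k ℕ.* k !) _ ⟩
  + (r ℕ.^ k ℕ.* k !) ℤ.* + tally (crosses c) (kSets n k)
    ≡⟨ cong (+ (r ℕ.^ k ℕ.* k !) ℤ.*_) (tally-crosses k c) ⟩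
  + (r ℕ.^ k ℕ.* k !) ℤ.* Δs (map (partSize c) (allFin r)) (binomial k) 0
    ≤⟨ Δs-binomial-bound k r (map (partSize c) (allFin r)) (trans (length-map (partSize c) (allFin r)) (length-tabulate id)) ⟩
  + (stirling2 k r ℕ.* r ! ℕ.* sum (map (partSize c) (allFin r)) ℕ.^ k)
    ≡⟨ cong (λ a → + (stirling2 k r ℕ.* r ! ℕ.* a ℕ.^ k)) (sum-partSize c) ⟩
  + (stirling2 k r ℕ.* r ! ℕ.* n ℕ.^ k) ∎)
  where open ℤ.≤-Reasoning

length-kSets : ∀ n k → length (kSets n k) ≡ n choose k
length-kSets n k = begin
  length (kSets n k)
    ≡⟨ length-filter (λ e → ∣ e ∣ ℕ.≟ k) (allSubsets n) ⟩
  tally (λ e → ∣ e ∣ ℕ.≡ᵇ k) (allSubsets n)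
    ≡⟨ tally-cong (λ e → sym (trans (cong ((∣ e ∣ ℕ.≡ᵇ k) ∧_) (avoid-none e c)) (Bool.∧-identityʳ _))) (allSubsets n) ⟩
  tally (λ e → (∣ e ∣ ℕ.≡ᵇ k) ∧ avoid (const false) e c) (allSubsets n)
    ≡⟨ tally-avoid k (const false) c ⟩
  free (const false) c choose k
    ≡⟨ cong (_choose k) (free-none c) ⟩
  n choose k ∎
  where
  open ≡-Reasoning
  -- An auxiliary cut with a single part: nothing is blocked, so every vertex is free and
  -- `tally-avoid` counts all k-sets.
  c : Cut n 1
  c = Vec.replicate n Fin.zero

-- Rational arithmetic

ℚ-ring : AlmostCommutativeRing 0ℓ 0ℓ
ℚ-ring = fromCommutativeRing ℚ.+-*-commutativeRing (λ p → dec⇒maybe (0ℚ ℚ.≟ p))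

*-monoˡ : ∀ {a b c} → 0ℚ ≤ℚ c → a ≤ℚ b → c * a ≤ℚ c * b
*-monoˡ {c = c} 0≤c = ℚ.*-monoˡ-≤-nonNeg c {{nonNegative 0≤c}}

*-monoʳ : ∀ {a b c} → 0ℚ ≤ℚ c → a ≤ℚ b → a * c ≤ℚ b * c
*-monoʳ {c = c} 0≤c = ℚ.*-monoʳ-≤-nonNeg c {{nonNegative 0≤c}}

*-mono : ∀ {a b c d} → 0ℚ ≤ℚ b → 0ℚ ≤ℚ c → a ≤ℚ b → c ≤ℚ d → a * c ≤ℚ b * d
*-mono 0≤b 0≤c a≤b c≤d = ℚ.≤-trans (*-monoʳ 0≤c a≤b) (*-monoˡ 0≤b c≤d)

*-nonneg : ∀ {a b} → 0ℚ ≤ℚ a → 0ℚ ≤ℚ b → 0ℚ ≤ℚ a * b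
*-nonneg {a} {b} 0≤a 0≤b = subst (_≤ℚ a * b) (ℚ.*-zeroʳ a) (*-monoˡ 0≤a 0≤b)

+-nonneg : ∀ {a b} → 0ℚ ≤ℚ a → 0ℚ ≤ℚ b → 0ℚ ≤ℚ a + b
+-nonneg = ℚ.+-mono-≤

*-cancelˡ : ∀ {a b} c → 0ℚ <ℚ c → c * a ≤ℚ c * b → a ≤ℚ b
*-cancelˡ c 0<c = ℚ.*-cancelˡ-≤-pos c {{positive 0<c}}

sub-nonneg : ∀ {a b} → a ≤ℚ b → 0ℚ ≤ℚ b - a
sub-nonneg {a} {b} a≤b = subst (_≤ℚ b - a) (ℚ.+-inverseʳ a) (ℚ.+-monoˡ-≤ (- a) a≤b)

nonneg-sub : ∀ {a b} → 0ℚ ≤ℚ b - a → a ≤ℚ b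
nonneg-sub {a} {b} h = subst₂′ (ℚ.+-monoʳ-≤ a h)
  where
  back : ∀ a b → a + (b - a) ≡ b
  back = solve-∀ ℚ-ring
  subst₂′ : a + 0ℚ ≤ℚ a + (b - a) → a ≤ℚ b
  subst₂′ = ≡.subst₂ _≤ℚ_ (ℚ.+-identityʳ a) (back a b)

square-nonneg : ∀ x → 0ℚ ≤ℚ x * x
square-nonneg x with ℚ.≤-total 0ℚ x
... | inj₁ 0≤x = *-nonneg 0≤x 0≤x
... | inj₂ x≤0 = subst (0ℚ ≤ℚ_) (neg-neg x) (*-nonneg 0≤-x 0≤-x)
  where
  0≤-x = ℚ.neg-antimono-≤ x≤0
  neg-neg : ∀ x → - x * - x ≡ x * x
  neg-neg = solve-∀ ℚ-ring

toℚᵘ-ι : ∀ a → toℚᵘ (ι a) ℚᵘ.≃ ℚᵘ.mkℚᵘ (+ a) 0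
toℚᵘ-ι a = ℚ.toℚᵘ-fromℚᵘ (ℚᵘ.mkℚᵘ (+ a) 0)

ι-+ : ∀ a b → ι (a ℕ.+ b) ≡ ι a + ι b
ι-+ a b = ℚ.toℚᵘ-injective (begin
  toℚᵘ (ι (a ℕ.+ b))                        ≈⟨ toℚᵘ-ι (a ℕ.+ b) ⟩
  ℚᵘ.mkℚᵘ (+ (a ℕ.+ b)) 0                   ≈⟨ ℚᵘ.*≡* (cong (ℤ._* + 1) (sym (cong₂ ℤ._+_ (ℤ.*-identityʳ (+ a)) (ℤ.*-identityʳ (+ b))))) ⟩
  ℚᵘ.mkℚᵘ (+ a) 0 ℚᵘ.+ ℚᵘ.mkℚᵘ (+ b) 0      ≈⟨ ℚᵘ.+-cong (ℚᵘ.≃-sym (toℚᵘ-ι a)) (ℚᵘ.≃-sym (toℚᵘ-ι b)) ⟩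
  toℚᵘ (ι a) ℚᵘ.+ toℚᵘ (ι b)                ≈⟨ ℚᵘ.≃-sym (ℚ.toℚᵘ-homo-+ (ι a) (ι b)) ⟩
  toℚᵘ (ι a + ι b)                          ∎)
  where open ℚᵘ.≃-Reasoning

ι-* : ∀ a b → ι (a ℕ.* b) ≡ ι a * ι b
ι-* a b = ℚ.toℚᵘ-injective (begin
  toℚᵘ (ι (a ℕ.* b))                        ≈⟨ toℚᵘ-ι (a ℕ.* b) ⟩
  ℚᵘ.mkℚᵘ (+ (a ℕ.* b)) 0                   ≈⟨ ℚᵘ.*≡* (cong (ℤ._* + 1) (ℤ.pos-* a b)) ⟩
  ℚᵘ.mkℚᵘ (+ a) 0 ℚᵘ.* ℚᵘ.mkℚᵘ (+ b) 0      ≈⟨ ℚᵘ.*-cong (ℚᵘ.≃-sym (toℚᵘ-ι a)) (ℚᵘ.≃-sym (toℚᵘ-ι b)) ⟩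
  toℚᵘ (ι a) ℚᵘ.* toℚᵘ (ι b)                ≈⟨ ℚᵘ.≃-sym (ℚ.toℚᵘ-homo-* (ι a) (ι b)) ⟩
  toℚᵘ (ι a * ι b)                          ∎)
  where open ℚᵘ.≃-Reasoning

ι-nonneg : ∀ a → 0ℚ ≤ℚ ι a
ι-nonneg a = ℚ.nonNegative⁻¹ (ι a) {{ℚ.normalize-nonNeg a 1}}

ι-mono : ∀ {a b} → a ≤ b → ι a ≤ℚ ι b
ι-mono {a} {b} a≤b with c , refl ← ℕ.m≤n⇒∃[o]m+o≡n a≤b =
  ≡.subst₂ _≤ℚ_ (ℚ.+-identityʳ (ι a)) (sym (ι-+ a c)) (ℚ.+-monoʳ-≤ (ι a) (ι-nonneg c))

ι-pos : ∀ a → 0ℚ <ℚ ι (suc a)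
ι-pos a = ℚ.positive⁻¹ (ι (suc a)) {{ℚ.normalize-pos (suc a) 1}}

ι-^ : ∀ a n → ι (a ℕ.^ n) ≡ ι a ^ n
ι-^ a zero    = refl
ι-^ a (suc n) = trans (ι-* a (a ℕ.^ n)) (cong (ι a *_) (ι-^ a n))

÷-nonneg : ∀ a d → 0ℚ ≤ℚ a ÷ d
÷-nonneg a zero    = ℚ.≤-refl
÷-nonneg a (suc d) = ℚ.nonNegative⁻¹ (a ÷ suc d) {{ℚ.normalize-nonNeg a (suc d)}}

÷-* : ∀ a d .{{_ : ℕ.NonZero d}} → (a ÷ d) * ι d ≡ ι a
÷-* a (suc d) = ℚ.toℚᵘ-injective (begin
  toℚᵘ ((a ÷ suc d) * ι (suc d))                 ≈⟨ ℚ.toℚᵘ-homo-* (a ÷ suc d) (ι (suc d)) ⟩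
  toℚᵘ (a ÷ suc d) ℚᵘ.* toℚᵘ (ι (suc d))         ≈⟨ ℚᵘ.*-cong (ℚ.toℚᵘ-fromℚᵘ (ℚᵘ.mkℚᵘ (+ a) d)) (toℚᵘ-ι (suc d)) ⟩
  ℚᵘ.mkℚᵘ (+ a) d ℚᵘ.* ℚᵘ.mkℚᵘ (+ suc d) 0       ≈⟨ ℚᵘ.*≡* (trans (ℤ.*-identityʳ _) (cong (λ e → + a ℤ.* + e) (sym (ℕ.*-identityʳ (suc d))))) ⟩
  ℚᵘ.mkℚᵘ (+ a) 0                                ≈⟨ ℚᵘ.≃-sym (toℚᵘ-ι a) ⟩
  toℚᵘ (ι a)                                     ∎)
  where open ℚᵘ.≃-Reasoning

^-nonneg : ∀ {t} n → 0ℚ ≤ℚ t → 0ℚ ≤ℚ t ^ n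
^-nonneg zero    0≤t = ι-nonneg 1
^-nonneg (suc n) 0≤t = *-nonneg 0≤t (^-nonneg n 0≤t)

^-pos : ∀ {t} n → 0ℚ <ℚ t → 0ℚ <ℚ t ^ n
^-pos zero    0<t = ι-pos 0
^-pos {t} (suc n) 0<t = ℚ.positive⁻¹ (t ^ suc n)
  {{ℚ.pos*pos⇒pos t {{positive 0<t}} (t ^ n) {{positive (^-pos n 0<t)}}}}

^-monoˡ : ∀ {s t} n → 0ℚ ≤ℚ s → s ≤ℚ t → s ^ n ≤ℚ t ^ n
^-monoˡ zero    0≤s s≤t = ℚ.≤-refl
^-monoˡ (suc n) 0≤s s≤t = *-mono (ℚ.≤-trans 0≤s s≤t) (^-nonneg n 0≤s) s≤t (^-monoˡ n 0≤s s≤t)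

1^n≡1 : ∀ n → 1ℚ ^ n ≡ 1ℚ
1^n≡1 zero    = refl
1^n≡1 (suc n) = trans (ℚ.*-identityˡ (1ℚ ^ n)) (1^n≡1 n)

1≤^ : ∀ {t} n → 1ℚ ≤ℚ t → 1ℚ ≤ℚ t ^ n
1≤^ {t} n 1≤t = subst (_≤ℚ t ^ n) (1^n≡1 n) (^-monoˡ n (ι-nonneg 1) 1≤t)

^≤1 : ∀ {t} n → 0ℚ ≤ℚ t → t ≤ℚ 1ℚ → t ^ n ≤ℚ 1ℚ
^≤1 {t} n 0≤t t≤1 = subst (t ^ n ≤ℚ_) (1^n≡1 n) (^-monoˡ n 0≤t t≤1)

^-monoʳ : ∀ {t m n} → 1ℚ ≤ℚ t → m ≤ n → t ^ m ≤ℚ t ^ n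
^-monoʳ {t} {m} 1≤t m≤n with d , refl ← ℕ.m≤n⇒∃[o]m+o≡n m≤n =
  ≡.subst₂ _≤ℚ_ (ℚ.*-identityʳ (t ^ m)) (sym (^-homo-* t m d))
    (*-monoˡ (^-nonneg m (ℚ.≤-trans (ι-nonneg 1) 1≤t)) (1≤^ d 1≤t))

^-antimonoʳ : ∀ {t m n} → 0ℚ ≤ℚ t → t ≤ℚ 1ℚ → m ≤ n → t ^ n ≤ℚ t ^ m
^-antimonoʳ {t} {m} 0≤t t≤1 m≤n with d , refl ← ℕ.m≤n⇒∃[o]m+o≡n m≤n =
  ≡.subst₂ _≤ℚ_ (sym (^-homo-* t m d)) (ℚ.*-identityʳ (t ^ m))
    (*-monoˡ (^-nonneg m 0≤t) (^≤1 d 0≤t t≤1))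

bernoulli : ∀ {y} n → 0ℚ ≤ℚ 1ℚ + y → 1ℚ + ι n * y ≤ℚ (1ℚ + y) ^ n
bernoulli {y} zero    h = ℚ.≤-reflexive (cong (_+_ 1ℚ) (ℚ.*-zeroˡ y))
bernoulli {y} (suc n) h = begin
  1ℚ + ι (suc n) * y                                   ≡⟨ cong (λ a → 1ℚ + a * y) (ι-+ 1 n) ⟩
  1ℚ + (1ℚ + ι n) * y                                  ≡⟨ sym (ℚ.+-identityʳ _) ⟩
  1ℚ + (1ℚ + ι n) * y + 0ℚ                             ≤⟨ ℚ.+-monoʳ-≤ (1ℚ + (1ℚ + ι n) * y) (*-nonneg (ι-nonneg n) (square-nonneg y)) ⟩
  1ℚ + (1ℚ + ι n) * y + ι n * (y * y)                  ≡⟨ expand (ι n) y ⟩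
  (1ℚ + y) * (1ℚ + ι n * y)                            ≤⟨ *-monoˡ h (bernoulli n h) ⟩
  (1ℚ + y) ^ suc n                                     ∎
  where
  open ℚ.≤-Reasoning
  expand : ∀ a y → 1ℚ + (1ℚ + a) * y + a * (y * y) ≡ (1ℚ + y) * (1ℚ + a * y)
  expand = solve-∀ ℚ-ring

difference-of-squares : ∀ y → (1ℚ + y) * (1ℚ - y) ≡ 1ℚ + - (y * y)
difference-of-squares = solve-∀ ℚ-ring

1-y²≤1 : ∀ y → 1ℚ + - (y * y) ≤ℚ 1ℚ
1-y²≤1 y = subst (1ℚ + - (y * y) ≤ℚ_) (ℚ.+-identityʳ 1ℚ) (ℚ.+-monoʳ-≤ 1ℚ (ℚ.neg-antimono-≤ (square-nonneg y)))

2ℚ : ℚ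
2ℚ = ι 2

-- A (1/M)-random subset S of M m n elements has E (1 + x)^|S| = (1 + x/M)^(M m n).
-- This is compared with (1 + x)^(m n) without real exponentials: Bernoulli gives
-- (1 + y)^M (1 − x) ≤ (1 + y)^M (1 − y)^M ≤ 1 and (1 − x²)^m ≥ 1/2.
-- Both signs of x are needed, one for each tail.
growth-bound : ∀ {x y} M m n → ι M * y ≡ x →
  0ℚ ≤ℚ 1ℚ + y → 0ℚ ≤ℚ 1ℚ - y → 0ℚ ≤ℚ 1ℚ + x → 0ℚ ≤ℚ 1ℚ - x → 2ℚ * (ι m * (x * x)) ≤ℚ 1ℚ →
  (1ℚ + y) ^ (M ℕ.* (m ℕ.* n)) ≤ℚ 2ℚ ^ n * (1ℚ + x) ^ (m ℕ.* n)
growth-bound {x} {y} M m n My≡x 0≤1+y 0≤1-y 0≤1+x 0≤1-x small = begin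
  u ^ (M ℕ.* (m ℕ.* n))                                   ≡⟨ sym (ℚ.*-identityʳ _) ⟩
  u ^ (M ℕ.* (m ℕ.* n)) * 1ℚ                              ≤⟨ *-monoˡ (^-nonneg (M ℕ.* (m ℕ.* n)) 0≤1+y) 1≤ ⟩
  u ^ (M ℕ.* (m ℕ.* n)) * (2ℚ ^ n * (t ^ (m ℕ.* n) * t′ ^ (m ℕ.* n)))
    ≡⟨ regroup (u ^ (M ℕ.* (m ℕ.* n))) (2ℚ ^ n) (t ^ (m ℕ.* n)) (t′ ^ (m ℕ.* n)) ⟩
  (2ℚ ^ n * t ^ (m ℕ.* n)) * (u ^ (M ℕ.* (m ℕ.* n)) * t′ ^ (m ℕ.* n))
    ≤⟨ *-monoˡ (*-nonneg (^-nonneg n (ι-nonneg 2)) (^-nonneg (m ℕ.* n) 0≤1+x)) ≤1 ⟩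
  (2ℚ ^ n * t ^ (m ℕ.* n)) * 1ℚ                           ≡⟨ ℚ.*-identityʳ _ ⟩
  2ℚ ^ n * t ^ (m ℕ.* n)                                  ∎
  where
  open ℚ.≤-Reasoning
  u = 1ℚ + y
  t = 1ℚ + x
  t′ = 1ℚ - x
  regroup : ∀ a b c d → a * (b * (c * d)) ≡ (b * c) * (a * d)
  regroup = solve-∀ ℚ-ring
  tt′≥0 : 0ℚ ≤ℚ 1ℚ + - (x * x)
  tt′≥0 = subst (0ℚ ≤ℚ_) (difference-of-squares x) (*-nonneg 0≤1+x 0≤1-x)
  half : 1ℚ ≤ℚ 2ℚ * (1ℚ + - (x * x)) ^ m
  half = begin
    1ℚ                                       ≡⟨⟩
    2ℚ - 1ℚ                                  ≤⟨ ℚ.+-monoʳ-≤ 2ℚ (ℚ.neg-antimono-≤ small) ⟩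
    2ℚ - 2ℚ * (ι m * (x * x))                ≡⟨ factor 2ℚ (ι m) (x * x) ⟩
    2ℚ * (1ℚ + ι m * - (x * x))              ≤⟨ *-monoˡ (ι-nonneg 2) (bernoulli m tt′≥0) ⟩
    2ℚ * (1ℚ + - (x * x)) ^ m                ∎
    where
    factor : ∀ a b c → a - a * (b * c) ≡ a * (1ℚ + b * - c)
    factor = solve-∀ ℚ-ring
  1≤ : 1ℚ ≤ℚ 2ℚ ^ n * (t ^ (m ℕ.* n) * t′ ^ (m ℕ.* n))
  1≤ = begin
    1ℚ                                               ≤⟨ 1≤^ n half ⟩
    (2ℚ * (1ℚ + - (x * x)) ^ m) ^ n                  ≡⟨ ^-distrib-* 2ℚ ((1ℚ + - (x * x)) ^ m) n ⟩
    2ℚ ^ n * ((1ℚ + - (x * x)) ^ m) ^ n              ≡⟨ cong (2ℚ ^ n *_) (^-assocʳ (1ℚ + - (x * x)) m n) ⟩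
    2ℚ ^ n * (1ℚ + - (x * x)) ^ (m ℕ.* n)            ≡⟨ cong (λ a → 2ℚ ^ n * a ^ (m ℕ.* n)) (sym (difference-of-squares x)) ⟩
    2ℚ ^ n * (t * t′) ^ (m ℕ.* n)                    ≡⟨ cong (2ℚ ^ n *_) (^-distrib-* t t′ (m ℕ.* n)) ⟩
    2ℚ ^ n * (t ^ (m ℕ.* n) * t′ ^ (m ℕ.* n))        ∎
  u^Mt′≤1 : u ^ M * t′ ≤ℚ 1ℚ
  u^Mt′≤1 = begin
    u ^ M * (1ℚ - x)                      ≡⟨ cong (λ a → u ^ M * (1ℚ - a)) (sym My≡x) ⟩
    u ^ M * (1ℚ - ι M * y)                ≡⟨ cong (λ a → u ^ M * (1ℚ + a)) (ℚ.neg-distribʳ-* (ι M) y) ⟩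
    u ^ M * (1ℚ + ι M * - y)              ≤⟨ *-monoˡ (^-nonneg M 0≤1+y) (bernoulli M 0≤1-y) ⟩
    u ^ M * (1ℚ - y) ^ M                  ≡⟨ sym (^-distrib-* u (1ℚ - y) M) ⟩
    (u * (1ℚ - y)) ^ M                    ≤⟨ ^≤1 M (*-nonneg 0≤1+y 0≤1-y) (subst (_≤ℚ 1ℚ) (sym (difference-of-squares y)) (1-y²≤1 y)) ⟩
    1ℚ                                    ∎
  ≤1 : u ^ (M ℕ.* (m ℕ.* n)) * t′ ^ (m ℕ.* n) ≤ℚ 1ℚ
  ≤1 = begin
    u ^ (M ℕ.* (m ℕ.* n)) * t′ ^ (m ℕ.* n)   ≡⟨ cong (_* t′ ^ (m ℕ.* n)) (sym (^-assocʳ u M (m ℕ.* n))) ⟩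
    (u ^ M) ^ (m ℕ.* n) * t′ ^ (m ℕ.* n)     ≡⟨ sym (^-distrib-* (u ^ M) t′ (m ℕ.* n)) ⟩
    (u ^ M * t′) ^ (m ℕ.* n)                 ≤⟨ ^≤1 (m ℕ.* n) (*-nonneg (^-nonneg M 0≤1+y) 0≤1-x) u^Mt′≤1 ⟩
    1ℚ                                       ∎

-- Finite probability spaces

𝔼 : {A : Set} → List (ℚ × A) → (A → ℚ) → ℚ
𝔼 []            f = 0ℚ
𝔼 ((w , x) ∷ L) f = w * f x + 𝔼 L f

NonNegWeights : {A : Set} → List (ℚ × A) → Set
NonNegWeights = All (λ wx → 0ℚ ≤ℚ proj₁ wx)

𝔼-mono : {A : Set} {L : List (ℚ × A)} {f g : A → ℚ} → NonNegWeights L → (∀ x → f x ≤ℚ g x) → 𝔼 L f ≤ℚ 𝔼 L g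
𝔼-mono []       f≤g = ℚ.≤-refl
𝔼-mono (0≤w ∷ nn) f≤g = ℚ.+-mono-≤ (*-monoˡ 0≤w (f≤g _)) (𝔼-mono nn f≤g)

𝔼-cong : {A : Set} (L : List (ℚ × A)) {f g : A → ℚ} → (∀ x → f x ≡ g x) → 𝔼 L f ≡ 𝔼 L g
𝔼-cong []            f≗g = refl
𝔼-cong ((w , x) ∷ L) f≗g = cong₂ (λ a b → w * a + b) (f≗g x) (𝔼-cong L f≗g)

𝔼-+ : {A : Set} (L : List (ℚ × A)) (f g : A → ℚ) → 𝔼 L (λ x → f x + g x) ≡ 𝔼 L f + 𝔼 L g
𝔼-+ []            f g = refl
𝔼-+ ((w , x) ∷ L) f g = trans (cong (_+_ (w * (f x + g x))) (𝔼-+ L f g))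
  (interchange w (f x) (g x) (𝔼 L f) (𝔼 L g))
  where
  interchange : ∀ w a b c d → w * (a + b) + (c + d) ≡ (w * a + c) + (w * b + d)
  interchange = solve-∀ ℚ-ring

𝔼-*ˡ : ∀ {A : Set} (L : List (ℚ × A)) c (f : A → ℚ) → 𝔼 L (λ x → c * f x) ≡ c * 𝔼 L f
𝔼-*ˡ []            c f = sym (ℚ.*-zeroʳ c)
𝔼-*ˡ ((w , x) ∷ L) c f = trans (cong (_+_ (w * (c * f x))) (𝔼-*ˡ L c f)) (pull w c (f x) (𝔼 L f))
  where
  pull : ∀ w c a b → w * (c * a) + c * b ≡ c * (w * a + b)
  pull = solve-∀ ℚ-ring

𝔼-++ : {A : Set} (L M : List (ℚ × A)) (f : A → ℚ) → 𝔼 (L ++ M) f ≡ 𝔼 L f + 𝔼 M f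
𝔼-++ []            M f = sym (ℚ.+-identityˡ _)
𝔼-++ ((w , x) ∷ L) M f = trans (cong (_+_ (w * f x)) (𝔼-++ L M f)) (sym (ℚ.+-assoc (w * f x) (𝔼 L f) (𝔼 M f)))

𝔼-reweight : ∀ {A B : Set} c (h : A → B) (L : List (ℚ × A)) (f : B → ℚ) →
  𝔼 (map (λ wx → c * proj₁ wx , h (proj₂ wx)) L) f ≡ c * 𝔼 L (f ∘ h)
𝔼-reweight c h []            f = sym (ℚ.*-zeroʳ c)
𝔼-reweight c h ((w , x) ∷ L) f = trans (cong (_+_ (c * w * f (h x))) (𝔼-reweight c h L f))
  (pull c w (f (h x)) (𝔼 L (f ∘ h)))
  where
  pull : ∀ c w a b → c * w * a + c * b ≡ c * (w * a + b)
  pull = solve-∀ ℚ-ring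

𝔼-indep-∷ : ∀ {A : Set} p (x : A) xs (f : List A → ℚ) →
  𝔼 (indep p (x ∷ xs)) f ≡ p * 𝔼 (indep p xs) (f ∘ (x ∷_)) + (1ℚ - p) * 𝔼 (indep p xs) f
𝔼-indep-∷ p x xs f = trans (𝔼-++ (map _ (indep p xs)) _ f)
  (cong₂ _+_ (𝔼-reweight p (x ∷_) (indep p xs) f) (𝔼-reweight (1ℚ - p) id (indep p xs) f))

indep-nonneg : {A : Set} {p : ℚ} → 0ℚ ≤ℚ p → p ≤ℚ 1ℚ → (xs : List A) → NonNegWeights (indep p xs)
indep-nonneg 0≤p p≤1 []       = ι-nonneg 1 ∷ []
indep-nonneg 0≤p p≤1 (x ∷ xs) = All.++⁺
  (All.map⁺ (All.map (*-nonneg 0≤p) (indep-nonneg 0≤p p≤1 xs)))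
  (All.map⁺ (All.map (*-nonneg (sub-nonneg p≤1)) (indep-nonneg 0≤p p≤1 xs)))

-- By independence the moment factorises: a counted element contributes p (1 + x) + (1 - p), any
-- other contributes 1.
𝔼-indep-^ : ∀ {A : Set} p x (b : A → Bool) xs →
  𝔼 (indep p xs) (λ S → (1ℚ + x) ^ tally b S) ≡ (1ℚ + p * x) ^ tally b xs
𝔼-indep-^ p x b [] = refl
𝔼-indep-^ p x b (a ∷ xs) = trans (𝔼-indep-∷ p a xs _) (step (b a))
  where
  IH = 𝔼-indep-^ p x b xs
  step : ∀ c → p * 𝔼 (indep p xs) (λ S → (1ℚ + x) ^ (𝟙 c ℕ.+ tally b S))
      + (1ℚ - p) * 𝔼 (indep p xs) (λ S → (1ℚ + x) ^ tally b S)
    ≡ (1ℚ + p * x) ^ (𝟙 c ℕ.+ tally b xs)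
  step true = trans
    (cong₂ (λ a b → p * a + (1ℚ - p) * b) (trans (𝔼-*ˡ (indep p xs) (1ℚ + x) _) (cong ((1ℚ + x) *_) IH)) IH)
    (collect p x ((1ℚ + p * x) ^ tally b xs))
    where
    collect : ∀ p x a → p * ((1ℚ + x) * a) + (1ℚ - p) * a ≡ (1ℚ + p * x) * a
    collect = solve-∀ ℚ-ring
  step false = trans (cong₂ (λ a b → p * a + (1ℚ - p) * b) IH IH) (collect p ((1ℚ + p * x) ^ tally b xs))
    where
    collect : ∀ p a → p * a + (1ℚ - p) * a ≡ a
    collect = solve-∀ ℚ-ring

-- The total mass is the degenerate exponential moment that counts no element.
𝔼-indep-1 : ∀ {A : Set} p (xs : List A) → 𝔼 (indep p xs) (const 1ℚ) ≡ 1ℚ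
𝔼-indep-1 p xs = begin
  𝔼 (indep p xs) (const 1ℚ)
    ≡⟨ 𝔼-cong (indep p xs) (λ S → cong ((1ℚ + 0ℚ) ^_) (sym (tally-false (λ _ → refl) S))) ⟩
  𝔼 (indep p xs) (λ S → (1ℚ + 0ℚ) ^ tally (const false) S)
    ≡⟨ 𝔼-indep-^ p 0ℚ (const false) xs ⟩
  (1ℚ + p * 0ℚ) ^ tally (const false) xs
    ≡⟨ cong ((1ℚ + p * 0ℚ) ^_) (tally-false (λ _ → refl) xs) ⟩
  1ℚ ∎
  where open ≡-Reasoning

Pr : {A : Set} → List (ℚ × A) → (A → Bool) → ℚ
Pr L E = 𝔼 L (λ x → ι (𝟙 (E x)))

-- The underscore is solved, by Prob≡Pr, to the step function of the fold in Prob,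
-- which mentions a conditional that is local to Prob and cannot be named here.
mutual
  private
    foldr-weights : ∀ k n (E : Hypergraph n → Bool) →
      let step : ℚ × Hypergraph n → ℚ → ℚ ; step = _ in ∀ L → foldr step 0ℚ L ≡ Pr L E

  Prob≡Pr : ∀ k n E → Prob k n E ≡ Pr (Gk k n) E
  Prob≡Pr k n E = foldr-weights k n E (Gk k n)

  foldr-weights k n E []            = refl
  foldr-weights k n E ((w , H) ∷ L) with E H
  ... | true  = cong₂ _+_ (sym (ℚ.*-identityʳ w)) (foldr-weights k n E L)
  ... | false = cong₂ _+_ (sym (ℚ.*-zeroʳ w)) (foldr-weights k n E L)

markov : ∀ {A : Set} {L : List (ℚ × A)} (f : A → ℚ) (E : A → Bool) z → NonNegWeights L →
  (∀ x → 0ℚ ≤ℚ f x) → (∀ x → E x ≡ true → z ≤ℚ f x) → z * Pr L E ≤ℚ 𝔼 L f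
markov {L = L} f E z nn 0≤f z≤f = subst (_≤ℚ 𝔼 L f) (𝔼-*ˡ L z _) (𝔼-mono nn bound)
  where
  bound : ∀ x → z * ι (𝟙 (E x)) ≤ℚ f x
  bound x with E x in eq
  ... | true  = subst (_≤ℚ f x) (sym (ℚ.*-identityʳ z)) (z≤f x eq)
  ... | false = subst (_≤ℚ f x) (sym (ℚ.*-zeroʳ z)) (0≤f x)

Pr-∨ : {A : Set} {L : List (ℚ × A)} (E F : A → Bool) → NonNegWeights L →
  Pr L (λ x → E x ∨ F x) ≤ℚ Pr L E + Pr L F
Pr-∨ {L = L} E F nn = subst (Pr L (λ x → E x ∨ F x) ≤ℚ_) (𝔼-+ L _ _)
  (𝔼-mono nn (λ x → subst (ι (𝟙 (E x ∨ F x)) ≤ℚ_) (ι-+ (𝟙 (E x)) (𝟙 (F x))) (ι-mono (bool (E x) (F x)))))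
  where
  bool : ∀ a b → 𝟙 (a ∨ b) ≤ 𝟙 a ℕ.+ 𝟙 b
  bool false b = ℕ.≤-refl
  bool true  b = s≤s z≤n

-- The union bound, with the factor z that Markov's inequality produces left in place.
Pr-any : ∀ {A B : Set} {L : List (ℚ × A)} (E : B → A → Bool) z h → NonNegWeights L → 0ℚ ≤ℚ z →
  (∀ b → z * Pr L (E b) ≤ℚ h) → ∀ bs → z * Pr L (λ x → any (λ b → E b x) bs) ≤ℚ ι (length bs) * h
Pr-any {L = L} E z h nn 0≤z bound [] = ℚ.≤-reflexive (begin
  z * 𝔼 L (const 0ℚ)      ≡⟨ cong (z *_) (trans (𝔼-cong L (λ _ → sym (ℚ.*-zeroˡ 0ℚ))) (𝔼-*ˡ L 0ℚ (const 0ℚ))) ⟩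
  z * (0ℚ * 𝔼 L (const 0ℚ)) ≡⟨ vanish z (𝔼 L (const 0ℚ)) ⟩
  0ℚ                       ≡⟨ sym (ℚ.*-zeroˡ h) ⟩
  0ℚ * h                   ∎)
  where
  open ≡-Reasoning
  vanish : ∀ z a → z * (0ℚ * a) ≡ 0ℚ
  vanish = solve-∀ ℚ-ring
Pr-any {L = L} E z h nn 0≤z bound (b ∷ bs) = begin
  z * Pr L (λ x → E b x ∨ any (λ b → E b x) bs)        ≤⟨ *-monoˡ 0≤z (Pr-∨ (E b) _ nn) ⟩
  z * (Pr L (E b) + Pr L (λ x → any (λ b → E b x) bs)) ≡⟨ ℚ.*-distribˡ-+ z _ _ ⟩
  z * Pr L (E b) + z * Pr L (λ x → any (λ b → E b x) bs) ≤⟨ ℚ.+-mono-≤ (bound b) (Pr-any E z h nn 0≤z bound bs) ⟩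
  h + ι (length bs) * h                                ≡⟨ collect (ι (length bs)) h ⟩
  (1ℚ + ι (length bs)) * h                             ≡⟨ cong (_* h) (sym (ι-+ 1 (length bs))) ⟩
  ι (suc (length bs)) * h                              ∎
  where
  open ℚ.≤-Reasoning
  collect : ∀ a h → h + a * h ≡ (1ℚ + a) * h
  collect = solve-∀ ℚ-ring

-- Elementary counting bounds

length-vecsOver : ∀ {A : Set} (xs : List A) n → length (vecsOver xs n) ≡ length xs ℕ.^ n
length-vecsOver xs zero    = refl
length-vecsOver xs (suc n) = trans (length-concatMap xs) (cong (length xs ℕ.*_) (length-vecsOver xs n))
  where
  length-concatMap : ∀ ys → length (concatMap (λ x → map (x Vec.∷_) (vecsOver xs n)) ys) ≡ length ys ℕ.* length (vecsOver xs n)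
  length-concatMap []       = refl
  length-concatMap (y ∷ ys) = trans (length-++ (map (y Vec.∷_) (vecsOver xs n)))
    (cong₂ ℕ._+_ (length-map (y Vec.∷_) (vecsOver xs n)) (length-concatMap ys))

k!*nCk≤n^k : ∀ k n → k ! ℕ.* (n choose k) ≤ n ℕ.^ k
k!*nCk≤n^k k n = ℤ.drop‿+≤+ (≡.subst₂ ℤ._≤_ (sym (ℤ.pos-* (k !) (n choose k))) (power-pos k n)
  (ℤ.0≤i-j⇒j≤i (am-power-binomial k [] n)))

-- This says that the falling factorial is at least n^k - k² n^(k-1), multiplied by n and freed of
-- subtraction. The square k² is a generous constant that closes the induction, as k² + k ≤ (k +
-- 1)².
n^1+k≤ : ∀ k n → n ℕ.* n ℕ.^ k ≤ n ℕ.* (k ! ℕ.* (n choose k)) ℕ.+ k ℕ.* k ℕ.* n ℕ.^ k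
n^1+k≤ zero    n = ℕ.≤-reflexive (sym (ℕ.+-identityʳ (n ℕ.* 1)))
n^1+k≤ (suc k) n = begin
  n ℕ.* (n ℕ.* P)                                          ≤⟨ ℕ.*-monoʳ-≤ n (n^1+k≤ k n) ⟩
  n ℕ.* (n ℕ.* G ℕ.+ k ℕ.* k ℕ.* P)                        ≡⟨ cong (λ a → n ℕ.* (a ℕ.+ k ℕ.* k ℕ.* P)) (n*k!*nCk n k) ⟩
  n ℕ.* (G′ ℕ.+ k ℕ.* G ℕ.+ k ℕ.* k ℕ.* P)                 ≤⟨ ℕ.*-monoʳ-≤ n (ℕ.+-monoˡ-≤ (k ℕ.* k ℕ.* P)
                                                                (ℕ.+-monoʳ-≤ G′ (ℕ.*-monoʳ-≤ k (k!*nCk≤n^k k n)))) ⟩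
  n ℕ.* (G′ ℕ.+ k ℕ.* P ℕ.+ k ℕ.* k ℕ.* P)                 ≤⟨ ℕ.m≤m+n _ (suc k ℕ.* (n ℕ.* P)) ⟩
  n ℕ.* (G′ ℕ.+ k ℕ.* P ℕ.+ k ℕ.* k ℕ.* P) ℕ.+ suc k ℕ.* (n ℕ.* P) ≡⟨ collect n k P G′ ⟩
  n ℕ.* G′ ℕ.+ suc k ℕ.* suc k ℕ.* (n ℕ.* P)               ∎
  where
  open ℕ.≤-Reasoning
  P  = n ℕ.^ k
  G  = k ! ℕ.* (n choose k)
  G′ = suc k ! ℕ.* (n choose suc k)
  collect : ∀ n k P G → n ℕ.* (G ℕ.+ k ℕ.* P ℕ.+ k ℕ.* k ℕ.* P) ℕ.+ suc k ℕ.* (n ℕ.* P)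
    ≡ n ℕ.* G ℕ.+ suc k ℕ.* suc k ℕ.* (n ℕ.* P)
  collect = ℕ-Ring.solve-∀

1+p*x-nonneg : ∀ {p x} → 0ℚ ≤ℚ p → p ≤ℚ 1ℚ → 0ℚ ≤ℚ 1ℚ + x → 0ℚ ≤ℚ 1ℚ + p * x
1+p*x-nonneg {p} {x} 0≤p p≤1 0≤1+x = subst (0ℚ ≤ℚ_) (collect p x)
  (+-nonneg (sub-nonneg p≤1) (*-nonneg 0≤p 0≤1+x))
  where
  collect : ∀ p x → (1ℚ - p) + p * (1ℚ + x) ≡ 1ℚ + p * x
  collect = solve-∀ ℚ-ring

-- Tail bounds

-- Chernoff's method for both tails: x > 0 for the upper and x < 0 for the lower. The number of
-- counted elements is compared with M m n, whose expected contribution is m n since p M = 1; the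
-- comparison must increase the moment, so its direction depends on the sign of x. The power (1 +
-- x)^(m n) occurs in both the Markov threshold and the moment bound and cancels.
tail-bound : ∀ {A : Set} {p x} M m n d (b : A → Bool) (E : List A → Bool) xs →
  0ℚ ≤ℚ p → p ≤ℚ 1ℚ → p * ι M ≡ 1ℚ →
  0ℚ <ℚ 1ℚ + x → 0ℚ ≤ℚ 1ℚ - x → 2ℚ * (ι m * (x * x)) ≤ℚ 1ℚ →
  (1ℚ + p * x) ^ tally b xs ≤ℚ (1ℚ + p * x) ^ (M ℕ.* (m ℕ.* n)) →
  (∀ S → E S ≡ true → 2ℚ ^ d * (1ℚ + x) ^ (m ℕ.* n) ≤ℚ (1ℚ + x) ^ tally b S) →
  2ℚ ^ d * Pr (indep p xs) E ≤ℚ 2ℚ ^ n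
tail-bound {p = p} {x} M m n d b E xs 0≤p p≤1 pM≡1 0<1+x 0≤1-x small size event =
  *-cancelˡ t (^-pos (m ℕ.* n) 0<1+x) (begin
  t * (2ℚ ^ d * Pr (indep p xs) E)            ≡⟨ regroup t (2ℚ ^ d) (Pr (indep p xs) E) ⟩
  2ℚ ^ d * t * Pr (indep p xs) E              ≤⟨ markov (λ S → (1ℚ + x) ^ tally b S) E (2ℚ ^ d * t) (indep-nonneg 0≤p p≤1 xs)
                                                  (λ S → ^-nonneg (tally b S) 0≤1+x) event ⟩
  𝔼 (indep p xs) (λ S → (1ℚ + x) ^ tally b S) ≡⟨ 𝔼-indep-^ p x b xs ⟩
  (1ℚ + p * x) ^ tally b xs                   ≤⟨ size ⟩
  (1ℚ + p * x) ^ (M ℕ.* (m ℕ.* n))            ≤⟨ growth-bound M m n My≡x (1+p*x-nonneg 0≤p p≤1 0≤1+x)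
                                                  (subst (λ a → 0ℚ ≤ℚ 1ℚ + a) (sym (ℚ.neg-distribʳ-* p x)) (1+p*x-nonneg 0≤p p≤1 0≤1-x))
                                                  0≤1+x 0≤1-x small ⟩
  2ℚ ^ n * t                                  ≡⟨ ℚ.*-comm (2ℚ ^ n) t ⟩
  t * 2ℚ ^ n                                  ∎)
  where
  open ℚ.≤-Reasoning
  t = (1ℚ + x) ^ (m ℕ.* n)
  0≤1+x = ℚ.<⇒≤ 0<1+x
  regroup : ∀ a b c → a * (b * c) ≡ b * a * c
  regroup = solve-∀ ℚ-ring
  My≡x : ι M * (p * x) ≡ x
  My≡x = trans (rotate (ι M) p x) (trans (cong (_* x) pM≡1) (ℚ.*-identityˡ x))
    where
    rotate : ∀ a b c → a * (b * c) ≡ b * a * c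
    rotate = solve-∀ ℚ-ring

N*1/N : ∀ N .{{_ : ℕ.NonZero N}} → ι N * (1 ÷ N) ≡ 1ℚ
N*1/N N = trans (ℚ.*-comm (ι N) (1 ÷ N)) (÷-* 1 N)

1÷-≤1 : ∀ N .{{_ : ℕ.NonZero N}} → 1 ÷ N ≤ℚ 1ℚ
1÷-≤1 N = ≡.subst₂ _≤ℚ_ (ℚ.*-identityʳ (1 ÷ N)) (÷-* 1 N) (*-monoˡ (÷-nonneg 1 N) (ι-mono (ℕ.>-nonZero⁻¹ N)))

square-small : ∀ m N .{{_ : ℕ.NonZero N}} → 2 ℕ.* m ≤ N ℕ.* N → 2ℚ * (ι m * ((1 ÷ N) * (1 ÷ N))) ≤ℚ 1ℚ
square-small m N 2m≤NN = begin
  2ℚ * (ι m * (δ * δ))       ≡⟨ sym (ℚ.*-assoc 2ℚ (ι m) (δ * δ)) ⟩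
  2ℚ * ι m * (δ * δ)         ≡⟨ cong (_* (δ * δ)) (sym (ι-* 2 m)) ⟩
  ι (2 ℕ.* m) * (δ * δ)      ≤⟨ *-monoʳ (square-nonneg δ) (ι-mono 2m≤NN) ⟩
  ι (N ℕ.* N) * (δ * δ)      ≡⟨ cong (_* (δ * δ)) (ι-* N N) ⟩
  ι N * ι N * (δ * δ)        ≡⟨ interchange (ι N) δ ⟩
  (ι N * δ) * (ι N * δ)      ≡⟨ cong₂ _*_ (N*1/N N) (N*1/N N) ⟩
  1ℚ                         ∎
  where
  open ℚ.≤-Reasoning
  δ = 1 ÷ N
  interchange : ∀ a b → a * a * (b * b) ≡ (a * b) * (a * b)
  interchange = solve-∀ ℚ-ring

-- With base 1 + 1/N, a deviation of N d is worth a factor of at least 2^d.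
2≤[1+1/N]^N : ∀ N .{{_ : ℕ.NonZero N}} → 2ℚ ≤ℚ (1ℚ + 1 ÷ N) ^ N
2≤[1+1/N]^N N = subst (_≤ℚ (1ℚ + 1 ÷ N) ^ N) (cong (_+_ 1ℚ) (N*1/N N))
  (bernoulli N (+-nonneg (ι-nonneg 1) (÷-nonneg 1 N)))

-- The lower-tail counterpart, obtained from the upper one because (1 - δ)(1 + δ) ≤ 1.
[1-1/N]^N*2≤1 : ∀ N .{{_ : ℕ.NonZero N}} → (1ℚ - 1 ÷ N) ^ N * 2ℚ ≤ℚ 1ℚ
[1-1/N]^N*2≤1 N = begin
  (1ℚ - δ) ^ N * 2ℚ              ≤⟨ *-monoˡ (^-nonneg N 0≤1-δ) (2≤[1+1/N]^N N) ⟩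
  (1ℚ - δ) ^ N * (1ℚ + δ) ^ N    ≡⟨ sym (^-distrib-* (1ℚ - δ) (1ℚ + δ) N) ⟩
  ((1ℚ - δ) * (1ℚ + δ)) ^ N      ≤⟨ ^≤1 N (*-nonneg 0≤1-δ (+-nonneg (ι-nonneg 1) (÷-nonneg 1 N)))
                                      (subst (_≤ℚ 1ℚ) (sym (trans (ℚ.*-comm (1ℚ - δ) (1ℚ + δ)) (difference-of-squares δ))) (1-y²≤1 δ)) ⟩
  1ℚ                             ∎
  where
  open ℚ.≤-Reasoning
  δ = 1 ÷ N
  0≤1-δ = sub-nonneg (1÷-≤1 N)

-- Positivity has to be strict because `tail-bound` cancels a power of this base; N = 1 would give
-- 0.
0<1-1/N : ∀ N .{{_ : ℕ.NonZero N}} → 2 ≤ N → 0ℚ <ℚ 1ℚ - 1 ÷ N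
0<1-1/N N 2≤N = ℚ.<-≤-trans (δ-pos N) (nonneg-sub (subst (0ℚ ≤ℚ_) (double δ) (sub-nonneg 2δ≤1)))
  where
  δ = 1 ÷ N
  δ-pos : ∀ N .{{_ : ℕ.NonZero N}} → 0ℚ <ℚ 1 ÷ N
  δ-pos (suc N) = ℚ.positive⁻¹ (1 ÷ suc N) {{ℚ.normalize-pos 1 (suc N)}}
  2δ≤1 : 2ℚ * δ ≤ℚ 1ℚ
  2δ≤1 = subst (2ℚ * δ ≤ℚ_) (N*1/N N) (*-monoʳ (÷-nonneg 1 N) (ι-mono 2≤N))
  double : ∀ δ → 1ℚ - 2ℚ * δ ≡ 1ℚ - δ - δ
  double = solve-∀ ℚ-ring

≤ᵇ-true⇒≤ : ∀ m n → (m ℕ.≤ᵇ n) ≡ true → m ≤ n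
≤ᵇ-true⇒≤ m n eq = ℕ.≤ᵇ⇒≤ m n (subst T (sym eq) _)

upper-tail : ∀ {A : Set} {p} M m n d N (b : A → Bool) xs .{{_ : ℕ.NonZero N}} →
  0ℚ ≤ℚ p → p ≤ℚ 1ℚ → p * ι M ≡ 1ℚ → 2 ℕ.* m ≤ N ℕ.* N → tally b xs ≤ M ℕ.* (m ℕ.* n) →
  2ℚ ^ d * Pr (indep p xs) (λ S → m ℕ.* n ℕ.+ N ℕ.* d ℕ.≤ᵇ tally b S) ≤ℚ 2ℚ ^ n
upper-tail {p = p} M m n d N b xs 0≤p p≤1 pM≡1 2m≤NN size =
  tail-bound M m n d b (λ S → m ℕ.* n ℕ.+ N ℕ.* d ℕ.≤ᵇ tally b S) xs 0≤p p≤1 pM≡1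
    (ℚ.<-≤-trans (ι-pos 0) 1≤t) (sub-nonneg (1÷-≤1 N)) (square-small m N 2m≤NN)
    (^-monoʳ 1≤1+pδ size) event
  where
  open ℚ.≤-Reasoning
  δ = 1 ÷ N
  t = 1ℚ + δ
  1≤1+ : ∀ {a} → 0ℚ ≤ℚ a → 1ℚ ≤ℚ 1ℚ + a
  1≤1+ {a} 0≤a = subst (_≤ℚ 1ℚ + a) (ℚ.+-identityʳ 1ℚ) (ℚ.+-monoʳ-≤ 1ℚ 0≤a)
  1≤t : 1ℚ ≤ℚ t
  1≤t = 1≤1+ (÷-nonneg 1 N)
  1≤1+pδ = 1≤1+ (*-nonneg 0≤p (÷-nonneg 1 N))
  event : ∀ S → (m ℕ.* n ℕ.+ N ℕ.* d ℕ.≤ᵇ tally b S) ≡ true → 2ℚ ^ d * t ^ (m ℕ.* n) ≤ℚ t ^ tally b S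
  event S eq = begin
    2ℚ ^ d * t ^ (m ℕ.* n)           ≤⟨ *-monoʳ (^-nonneg (m ℕ.* n) (ℚ.≤-trans (ι-nonneg 1) 1≤t))
                                          (^-monoˡ d (ι-nonneg 2) (2≤[1+1/N]^N N)) ⟩
    (t ^ N) ^ d * t ^ (m ℕ.* n)      ≡⟨ cong (_* t ^ (m ℕ.* n)) (^-assocʳ t N d) ⟩
    t ^ (N ℕ.* d) * t ^ (m ℕ.* n)    ≡⟨ ℚ.*-comm (t ^ (N ℕ.* d)) (t ^ (m ℕ.* n)) ⟩
    t ^ (m ℕ.* n) * t ^ (N ℕ.* d)    ≡⟨ sym (^-homo-* t (m ℕ.* n) (N ℕ.* d)) ⟩
    t ^ (m ℕ.* n ℕ.+ N ℕ.* d)        ≤⟨ ^-monoʳ 1≤t (≤ᵇ-true⇒≤ (m ℕ.* n ℕ.+ N ℕ.* d) (tally b S) eq) ⟩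
    t ^ tally b S                    ∎

-- Here x = -1/N, so powers decrease in the exponent and the size hypothesis becomes a lower bound.
-- The event has N d on the left, which avoids truncated subtraction.
lower-tail : ∀ {A : Set} {p} M m n d N (b : A → Bool) xs .{{_ : ℕ.NonZero N}} → 2 ≤ N →
  0ℚ ≤ℚ p → p ≤ℚ 1ℚ → p * ι M ≡ 1ℚ → 2 ℕ.* m ≤ N ℕ.* N → M ℕ.* (m ℕ.* n) ≤ tally b xs →
  2ℚ ^ d * Pr (indep p xs) (λ S → tally b S ℕ.+ N ℕ.* d ℕ.≤ᵇ m ℕ.* n) ≤ℚ 2ℚ ^ n
lower-tail {p = p} M m n d N b xs 2≤N 0≤p p≤1 pM≡1 2m≤NN size =
  tail-bound M m n d b (λ S → tally b S ℕ.+ N ℕ.* d ℕ.≤ᵇ m ℕ.* n) xs 0≤p p≤1 pM≡1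
    0<s (+-nonneg (ι-nonneg 1) (subst (0ℚ ≤ℚ_) (sym (neg-neg δ)) (÷-nonneg 1 N)))
    (subst (λ a → 2ℚ * (ι m * a) ≤ℚ 1ℚ) (sym (neg*neg δ)) (square-small m N 2m≤NN))
    (^-antimonoʳ (1+p*x-nonneg 0≤p p≤1 0≤s) 1-pδ≤1 size) event
  where
  open ℚ.≤-Reasoning
  δ = 1 ÷ N
  s = 1ℚ - δ
  0<s = 0<1-1/N N 2≤N
  0≤s = ℚ.<⇒≤ 0<s
  neg-neg : ∀ a → - (- a) ≡ a
  neg-neg = solve-∀ ℚ-ring
  neg*neg : ∀ a → - a * - a ≡ a * a
  neg*neg = solve-∀ ℚ-ring
  1-≤1 : ∀ {a} → 0ℚ ≤ℚ a → 1ℚ - a ≤ℚ 1ℚ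
  1-≤1 {a} 0≤a = subst (1ℚ - a ≤ℚ_) (ℚ.+-identityʳ 1ℚ) (ℚ.+-monoʳ-≤ 1ℚ (ℚ.neg-antimono-≤ 0≤a))
  1-pδ≤1 : 1ℚ + p * - δ ≤ℚ 1ℚ
  1-pδ≤1 = subst (λ a → 1ℚ + a ≤ℚ 1ℚ) (ℚ.neg-distribʳ-* p δ) (1-≤1 (*-nonneg 0≤p (÷-nonneg 1 N)))
  event : ∀ S → (tally b S ℕ.+ N ℕ.* d ℕ.≤ᵇ m ℕ.* n) ≡ true → 2ℚ ^ d * s ^ (m ℕ.* n) ≤ℚ s ^ tally b S
  event S eq = begin
    2ℚ ^ d * s ^ (m ℕ.* n)                    ≤⟨ *-monoˡ (^-nonneg d (ι-nonneg 2)) (^-antimonoʳ 0≤s (1-≤1 (÷-nonneg 1 N)) (≤ᵇ-true⇒≤ (tally b S ℕ.+ N ℕ.* d) (m ℕ.* n) eq)) ⟩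
    2ℚ ^ d * s ^ (tally b S ℕ.+ N ℕ.* d)      ≡⟨ cong (2ℚ ^ d *_) (^-homo-* s (tally b S) (N ℕ.* d)) ⟩
    2ℚ ^ d * (s ^ tally b S * s ^ (N ℕ.* d))  ≡⟨ cong (λ a → 2ℚ ^ d * (s ^ tally b S * a)) (sym (^-assocʳ s N d)) ⟩
    2ℚ ^ d * (s ^ tally b S * (s ^ N) ^ d)    ≡⟨ rotate (2ℚ ^ d) (s ^ tally b S) ((s ^ N) ^ d) ⟩
    s ^ tally b S * ((s ^ N) ^ d * 2ℚ ^ d)    ≡⟨ cong (s ^ tally b S *_) (sym (^-distrib-* (s ^ N) 2ℚ d)) ⟩
    s ^ tally b S * (s ^ N * 2ℚ) ^ d          ≤⟨ *-monoˡ (^-nonneg (tally b S) 0≤s)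
                                                   (^≤1 d (*-nonneg (^-nonneg N 0≤s) (ι-nonneg 2)) ([1-1/N]^N*2≤1 N)) ⟩
    s ^ tally b S * 1ℚ                        ≡⟨ ℚ.*-identityʳ _ ⟩
    s ^ tally b S                             ∎
    where
    rotate : ∀ a b c → a * (b * c) ≡ b * (c * a)
    rotate = solve-∀ ℚ-ring

-- The union bound over cuts

-- The denominator of ε suffices, because its numerator is at least 1.
archimedean : ∀ ε → 0ℚ <ℚ ε → ∃ λ N → 1ℚ ≤ℚ ι N * ε
archimedean ε@(ℚ.mkℚ (+ suc a) d c) 0<ε = suc d , (begin
  1ℚ                       ≤⟨ ι-mono {1} {suc a} (s≤s z≤n) ⟩
  ι (suc a)                ≡⟨ sym (÷-* (suc a) (suc d)) ⟩
  (suc a ÷ suc d) * ι (suc d) ≡⟨ cong (_* ι (suc d)) (ℚ.↥p/↧p≡p ε) ⟩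
  ε * ι (suc d)            ≡⟨ ℚ.*-comm ε (ι (suc d)) ⟩
  ι (suc d) * ε            ∎)
  where open ℚ.≤-Reasoning
archimedean (ℚ.mkℚ (+ zero) d c) 0<ε with () ← ℤ.Positive.pos (positive 0<ε)
archimedean (ℚ.mkℚ ℤ.-[1+ a ] d c) 0<ε with () ← ℤ.Positive.pos (positive 0<ε)

n≤2^n : ∀ n → n ≤ 2 ℕ.^ n
n≤2^n zero    = z≤n
n≤2^n (suc n) = begin
  suc n                          ≤⟨ ℕ.+-mono-≤ (ℕ.m^n>0 2 n) (n≤2^n n) ⟩
  2 ℕ.^ n ℕ.+ 2 ℕ.^ n            ≡⟨ cong (2 ℕ.^ n ℕ.+_) (sym (ℕ.+-identityʳ (2 ℕ.^ n))) ⟩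
  2 ℕ.^ suc n                    ∎
  where open ℕ.≤-Reasoning

-- Origin of r + 2: since r ≤ 2^r, the cuts number at most 2^(r n); one further 2^n is the factor
-- left by each tail bound, and another covers the doubling caused by the extra event on the edges.
union-size : ∀ r n → 1 ≤ n → suc (r ℕ.^ n) ℕ.* 2 ℕ.^ n ≤ 2 ℕ.^ ((r ℕ.+ 2) ℕ.* n)
union-size r n 1≤n = begin
  suc (r ℕ.^ n) ℕ.* 2 ℕ.^ n              ≤⟨ ℕ.*-monoˡ-≤ (2 ℕ.^ n) (ℕ.+-mono-≤ (ℕ.m^n>0 2 (r ℕ.* n)) r^n≤) ⟩
  (2 ℕ.^ (r ℕ.* n) ℕ.+ 2 ℕ.^ (r ℕ.* n)) ℕ.* 2 ℕ.^ n
    ≡⟨ cong (ℕ._* 2 ℕ.^ n) (double (2 ℕ.^ (r ℕ.* n))) ⟩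
  2 ℕ.^ (r ℕ.* n) ℕ.* 2 ℕ.^ 1 ℕ.* 2 ℕ.^ n
    ≤⟨ ℕ.*-monoˡ-≤ (2 ℕ.^ n) (ℕ.*-monoʳ-≤ (2 ℕ.^ (r ℕ.* n)) (ℕ.^-monoʳ-≤ 2 1≤n)) ⟩
  2 ℕ.^ (r ℕ.* n) ℕ.* 2 ℕ.^ n ℕ.* 2 ℕ.^ n
    ≡⟨ sym (trans (ℕ.^-distribˡ-+-* 2 (r ℕ.* n ℕ.+ n) n) (cong (ℕ._* 2 ℕ.^ n) (ℕ.^-distribˡ-+-* 2 (r ℕ.* n) n))) ⟩
  2 ℕ.^ (r ℕ.* n ℕ.+ n ℕ.+ n)
    ≡⟨ cong (2 ℕ.^_) (collect r n) ⟩
  2 ℕ.^ ((r ℕ.+ 2) ℕ.* n) ∎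
  where
  open ℕ.≤-Reasoning
  r^n≤ : r ℕ.^ n ≤ 2 ℕ.^ (r ℕ.* n)
  r^n≤ = subst (r ℕ.^ n ≤_) (ℕ.^-*-assoc 2 r n) (ℕ.^-monoˡ-≤ n (n≤2^n r))
  double : ∀ a → a ℕ.+ a ≡ a ℕ.* 2
  double = ℕ-Ring.solve-∀
  collect : ∀ r n → r ℕ.* n ℕ.+ n ℕ.+ n ≡ (r ℕ.+ 2) ℕ.* n
  collect = ℕ-Ring.solve-∀

all-or-any : {A : Set} {f g : A → Bool} → (∀ x → f x ∨ g x ≡ true) → ∀ xs →
  any f xs ≡ false → all g xs ≡ true
all-or-any f∨g []       _ = refl
all-or-any {f = f} {g} f∨g (x ∷ xs) none with f x | f∨g x
... | false | gx = cong₂ _∧_ gx (all-or-any f∨g xs none)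

T⇒≡true : ∀ {b} → T b → b ≡ true
T⇒≡true {true} _ = refl

-- Multiplying by r^k reduces a bound on the rational excess to an inequality between natural
-- numbers.
excess-≤ : ∀ k r {n} (H : Hypergraph n) (c : Cut n r) X .{{_ : ℕ.NonZero r}} →
  r ℕ.^ k ℕ.* cutSize H c ≤ r ℕ.^ k ℕ.* X ℕ.+ stirling2 k r ℕ.* r ! ℕ.* edges H →
  excess k r H c ≤ℚ ι X
excess-≤ k r H c X h = nonneg-sub (*-cancelˡ-nonneg (begin
  0ℚ                                             ≤⟨ sub-nonneg (ι-mono h) ⟩
  ι (R ℕ.* X ℕ.+ a ℕ.* edges H) - ι (R ℕ.* cutSize H c)
    ≡⟨ cong₂ _-_ (trans (ι-+ (R ℕ.* X) (a ℕ.* edges H)) (cong₂ _+_ (ι-* R X) (ι-* a (edges H)))) (ι-* R (cutSize H c)) ⟩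
  ι R * ι X + ι a * ι (edges H) - ι R * ι (cutSize H c)
    ≡⟨ cong (λ b → ι R * ι X + b * ι (edges H) - ι R * ι (cutSize H c)) (sym (÷-* a R)) ⟩
  ι R * ι X + (a ÷ R) * ι R * ι (edges H) - ι R * ι (cutSize H c)
    ≡⟨ factor (ι R) (ι X) (a ÷ R) (ι (edges H)) (ι (cutSize H c)) ⟩
  ι R * (ι X - excess k r H c) ∎))
  where
  open ℚ.≤-Reasoning
  R = r ℕ.^ k
  a = stirling2 k r ℕ.* r !
  instance _ = ℕ.m^n≢0 r k
  factor : ∀ R x q h c → R * x + q * R * h - R * c ≡ R * (x - (c - q * h))
  factor = solve-∀ ℚ-ring
  *-cancelˡ-nonneg : ∀ {y} → 0ℚ ≤ℚ ι R * y → 0ℚ ≤ℚ y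
  *-cancelˡ-nonneg {y} 0≤Ry = *-cancelˡ (ι R) (ℚ.<-≤-trans (ι-pos 0) (ι-mono (ℕ.m^n>0 r k)))
    (subst (_≤ℚ ι R * y) (sym (ℚ.*-zeroʳ (ι R))) 0≤Ry)

≤ᵇ-false⇒> : ∀ m n → (m ℕ.≤ᵇ n) ≡ false → n < m
≤ᵇ-false⇒> m n eq = ℕ.≰⇒> (λ m≤n → subst T eq (ℕ.≤⇒≤ᵇ m≤n))

tally-true : {A : Set} (xs : List A) → tally (const true) xs ≡ length xs
tally-true []       = refl
tally-true (_ ∷ xs) = cong suc (tally-true xs)

∨-elimˡ : ∀ a b → (a ≡ false → b ≡ true) → a ∨ b ≡ true
∨-elimˡ true  b h = refl
∨-elimˡ false b h = h refl

∨-elim-false : ∀ g u v → (u ≡ false → v ≡ false → g ≡ true) → g ∨ (u ∨ v) ≡ true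
∨-elim-false true  u     v     h = refl
∨-elim-false false true  v     h = refl
∨-elim-false false false true  h = refl
∨-elim-false false false false h = h refl refl

-- Here m n is the target size of a cut and m′ n that of the edge set, up to an error of
-- N d = O(n²).  Each of the r^n + 1 bad events has probability at most 2^(n − d), so that
-- d = (r + 3) n leaves a total of at most 2^(−n).
failure-bound : ∀ k r K D n M m m′ N .{{_ : ℕ.NonZero M}} .{{_ : ℕ.NonZero N}} → n ℕ.^ (k ℕ.∸ 3) ≡ M → 1 ≤ n → 2 ≤ N →
  let d = (r ℕ.+ 2) ℕ.* n ℕ.+ n in
  2 ℕ.* m ≤ N ℕ.* N → 2 ℕ.* m′ ≤ N ℕ.* N →
  (∀ c → tally (crosses {n} {r} c) (kSets n k) ≤ M ℕ.* (m ℕ.* n)) →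
  M ℕ.* (m′ ℕ.* n) ≤ tally (const true) (kSets n k) →
  (∀ H → m′ ℕ.* n ≤ edges H ℕ.+ N ℕ.* d → ∀ c →
    cutSize H c ≤ m ℕ.* n ℕ.+ N ℕ.* d → excess k r H c ≤ℚ ι (K ℕ.* n ℕ.^ 2)) →
  (∀ (H : Hypergraph n) → m′ ℕ.* n ≤ edges H ℕ.+ N ℕ.* d → (K ℕ.* n ℕ.^ 2) ℕ.^ 3 ≤ D ℕ.^ 3 ℕ.* edges H ℕ.^ 2) →
  2ℚ ^ n * (1ℚ - Prob k n (goodEvent k r K D n)) ≤ℚ 1ℚ
failure-bound k r K D n M m m′ N n^[k-3]≡M 1≤n 2≤N 2m≤NN 2m′≤NN cut-size edge-size excess-ok edges-ok =
  -- As d = e + n, the factor 2^e is what the union bound uses up and 2^n is what remains.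
  *-cancelˡ (2ℚ ^ e) (^-pos e (ι-pos 1)) (begin
  2ℚ ^ e * (2ℚ ^ n * (1ℚ - Prob k n G))        ≡⟨ sym (ℚ.*-assoc (2ℚ ^ e) (2ℚ ^ n) (1ℚ - Prob k n G)) ⟩
  2ℚ ^ e * 2ℚ ^ n * (1ℚ - Prob k n G)          ≡⟨ cong₂ (λ a b → a * (1ℚ - b)) (sym (^-homo-* 2ℚ e n)) (Prob≡Pr k n G) ⟩
  2ℚ ^ d * (1ℚ - Pr Ω G)                       ≤⟨ *-monoˡ (^-nonneg d (ι-nonneg 2)) 1-Pr≤ ⟩
  2ℚ ^ d * (Pr Ω U + Pr Ω V)                   ≡⟨ ℚ.*-distribˡ-+ (2ℚ ^ d) (Pr Ω U) (Pr Ω V) ⟩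
  2ℚ ^ d * Pr Ω U + 2ℚ ^ d * Pr Ω V            ≤⟨ ℚ.+-mono-≤
    (Pr-any (λ c H → T₀ ℕ.≤ᵇ tally (crosses c) H) (2ℚ ^ d) (2ℚ ^ n) Ω-nonneg (^-nonneg d (ι-nonneg 2))
      (λ c → upper-tail M m n d N (crosses c) (kSets n k) 0≤p p≤1 pM≡1 2m≤NN (cut-size c)) (allCuts n r))
    (lower-tail M m′ n d N (const true) (kSets n k) 2≤N 0≤p p≤1 pM≡1 2m′≤NN edge-size) ⟩
  ι (length (allCuts n r)) * 2ℚ ^ n + 2ℚ ^ n   ≡⟨ cong (λ a → ι a * 2ℚ ^ n + 2ℚ ^ n) length-cuts ⟩
  ι (r ℕ.^ n) * 2ℚ ^ n + 2ℚ ^ n                ≡⟨ collect (ι (r ℕ.^ n)) (2ℚ ^ n) ⟩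
  (1ℚ + ι (r ℕ.^ n)) * 2ℚ ^ n                  ≡⟨ cong₂ _*_ (sym (ι-+ 1 (r ℕ.^ n))) (sym (ι-^ 2 n)) ⟩
  ι (suc (r ℕ.^ n)) * ι (2 ℕ.^ n)              ≡⟨ sym (ι-* (suc (r ℕ.^ n)) (2 ℕ.^ n)) ⟩
  ι (suc (r ℕ.^ n) ℕ.* 2 ℕ.^ n)                ≤⟨ ι-mono (union-size r n 1≤n) ⟩
  ι (2 ℕ.^ e)                                  ≡⟨ ι-^ 2 e ⟩
  2ℚ ^ e                                       ≡⟨ sym (ℚ.*-identityʳ (2ℚ ^ e)) ⟩
  2ℚ ^ e * 1ℚ                                  ∎)
  where
  open ℚ.≤-Reasoning
  e = (r ℕ.+ 2) ℕ.* n
  d = e ℕ.+ n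
  T₀ = m ℕ.* n ℕ.+ N ℕ.* d
  G = goodEvent k r K D n
  Ω = Gk k n
  p = edgeProb k n
  U V : Hypergraph n → Bool
  U H = any (λ c → T₀ ℕ.≤ᵇ tally (crosses c) H) (allCuts n r)
  V H = tally (const true) H ℕ.+ N ℕ.* d ℕ.≤ᵇ m′ ℕ.* n
  1÷M≡p : 1 ÷ M ≡ p
  1÷M≡p = cong (1 ÷_) (sym n^[k-3]≡M)
  0≤p : 0ℚ ≤ℚ p
  0≤p = ÷-nonneg 1 (n ℕ.^ (k ℕ.∸ 3))
  p≤1 : p ≤ℚ 1ℚ
  p≤1 = subst (_≤ℚ 1ℚ) 1÷M≡p (1÷-≤1 M)
  pM≡1 : p * ι M ≡ 1ℚ
  pM≡1 = subst (λ a → a * ι M ≡ 1ℚ) 1÷M≡p (÷-* 1 M)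
  Ω-nonneg : NonNegWeights Ω
  Ω-nonneg = indep-nonneg 0≤p p≤1 (kSets n k)
  length-cuts : length (allCuts n r) ≡ r ℕ.^ n
  length-cuts = trans (length-vecsOver (allFin r) n) (cong (ℕ._^ n) (length-tabulate id))
  collect : ∀ a b → a * b + b ≡ (1ℚ + a) * b
  collect = solve-∀ ℚ-ring
  cut-or-excess : ∀ H → m′ ℕ.* n ≤ edges H ℕ.+ N ℕ.* d → ∀ c →
    (T₀ ℕ.≤ᵇ tally (crosses c) H) ∨ (excess k r H c ℚ.≤ᵇ ι (K ℕ.* n ℕ.^ 2)) ≡ true
  cut-or-excess H many c = ∨-elimˡ (T₀ ℕ.≤ᵇ tally (crosses c) H) _ λ eq →
    T⇒≡true (ℚ.≤⇒≤ᵇ (excess-ok H many c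
      (subst (_≤ T₀) (sym (length-filter-true (crosses c) H)) (ℕ.<⇒≤ (≤ᵇ-false⇒> T₀ (tally (crosses c) H) eq)))))
  -- Outside the bad events U (some cut too large) and V (too few edges), both conjuncts of the good
  -- event follow deterministically.
  cover : ∀ H → G H ∨ (U H ∨ V H) ≡ true
  cover H = ∨-elim-false (G H) (U H) (V H) λ U≡ V≡ →
    let many = subst (λ a → m′ ℕ.* n ≤ a ℕ.+ N ℕ.* d) (tally-true H)
                 (ℕ.<⇒≤ (≤ᵇ-false⇒> (tally (const true) H ℕ.+ N ℕ.* d) (m′ ℕ.* n) V≡))
    in cong₂ _∧_ (all-or-any (cut-or-excess H many) (allCuts n r) U≡) (T⇒≡true (ℕ.≤⇒≤ᵇ (edges-ok H many)))
  1-Pr≤ : 1ℚ - Pr Ω G ≤ℚ Pr Ω U + Pr Ω V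
  1-Pr≤ = nonneg-sub (subst (0ℚ ≤ℚ_) (swap (Pr Ω G) (Pr Ω U + Pr Ω V)) (sub-nonneg (begin
    1ℚ                                     ≡⟨ sym (𝔼-indep-1 p (kSets n k)) ⟩
    𝔼 Ω (const 1ℚ)                         ≡⟨ 𝔼-cong Ω (λ H → cong (ι ∘ 𝟙) (sym (cover H))) ⟩
    Pr Ω (λ H → G H ∨ (U H ∨ V H))         ≤⟨ Pr-∨ G (λ H → U H ∨ V H) Ω-nonneg ⟩
    Pr Ω G + Pr Ω (λ H → U H ∨ V H)        ≤⟨ ℚ.+-monoʳ-≤ (Pr Ω G) (Pr-∨ U V Ω-nonneg) ⟩
    Pr Ω G + (Pr Ω U + Pr Ω V)             ∎)))
    where
    swap : ∀ a b → a + b - 1ℚ ≡ b - (1ℚ - a)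
    swap = solve-∀ ℚ-ring

-- Collecting the error terms

-- The summands of the constant have distinct sources: 1 from rounding m up, a k² from replacing n^k
-- by a falling factorial, a B from the lower tail of the edge count, a from rounding m′ down, and B
-- from the upper tail of the cut.
excess-arithmetic : ∀ a R F B k² n m m′ cut H → 1 ≤ n → 1 ≤ F → 1 ≤ R →
  R ℕ.* F ℕ.* m ≤ R ℕ.* F ℕ.+ a ℕ.* (n ℕ.* n) →
  n ℕ.* n ≤ k² ℕ.* n ℕ.+ F ℕ.* suc m′ →
  cut ≤ m ℕ.* n ℕ.+ B ℕ.* (n ℕ.* n) →
  m′ ℕ.* n ≤ H ℕ.+ B ℕ.* (n ℕ.* n) →
  R ℕ.* cut ≤ R ℕ.* ((1 ℕ.+ a ℕ.* k² ℕ.+ a ℕ.* B ℕ.+ a ℕ.+ B) ℕ.* (n ℕ.* n)) ℕ.+ a ℕ.* H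
excess-arithmetic a R F B k² n m m′ cut H 1≤n 1≤F 1≤R m≤ n²≤ cut≤ H≥ =
  ℕ.*-cancelˡ-≤ F {{ℕ.>-nonZero 1≤F}} (begin
  F ℕ.* (R ℕ.* cut)                                     ≤⟨ ℕ.*-monoʳ-≤ F (ℕ.*-monoʳ-≤ R cut≤) ⟩
  F ℕ.* (R ℕ.* (m ℕ.* n ℕ.+ B ℕ.* q))                   ≡⟨ e₁ F R m n B q ⟩
  R ℕ.* F ℕ.* m ℕ.* n ℕ.+ F ℕ.* R ℕ.* (B ℕ.* q)         ≤⟨ ℕ.+-monoˡ-≤ _ (ℕ.*-monoˡ-≤ n m≤) ⟩
  (R ℕ.* F ℕ.+ a ℕ.* q) ℕ.* n ℕ.+ F ℕ.* R ℕ.* (B ℕ.* q) ≡⟨ e₂ R F a n q B ⟩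
  F ℕ.* R ℕ.* n ℕ.+ a ℕ.* n ℕ.* q ℕ.+ F ℕ.* R ℕ.* (B ℕ.* q)
    ≤⟨ ℕ.+-monoˡ-≤ _ (ℕ.+-mono-≤ (ℕ.*-monoʳ-≤ (F ℕ.* R) n≤q) (ℕ.*-monoʳ-≤ (a ℕ.* n) n²≤)) ⟩
  F ℕ.* R ℕ.* q ℕ.+ a ℕ.* n ℕ.* (k² ℕ.* n ℕ.+ F ℕ.* suc m′) ℕ.+ F ℕ.* R ℕ.* (B ℕ.* q)
    ≡⟨ e₃ F R a n k² m′ B ⟩
  F ℕ.* R ℕ.* q ℕ.+ (a ℕ.* k² ℕ.* q ℕ.+ F ℕ.* a ℕ.* n ℕ.+ F ℕ.* a ℕ.* (m′ ℕ.* n)) ℕ.+ F ℕ.* R ℕ.* (B ℕ.* q)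
    ≤⟨ ℕ.+-monoˡ-≤ _ (ℕ.+-monoʳ-≤ (F ℕ.* R ℕ.* q) (ℕ.+-mono-≤
         (ℕ.+-mono-≤ (grow (a ℕ.* k² ℕ.* q) (ℕ.*-mono-≤ 1≤F 1≤R))
            (ℕ.≤-trans (ℕ.*-monoʳ-≤ (F ℕ.* a) n≤q) (growR (F ℕ.* a ℕ.* q))))
         (ℕ.*-monoʳ-≤ (F ℕ.* a) H≥))) ⟩
  F ℕ.* R ℕ.* q ℕ.+ (F ℕ.* R ℕ.* (a ℕ.* k² ℕ.* q) ℕ.+ R ℕ.* (F ℕ.* a ℕ.* q) ℕ.+ F ℕ.* a ℕ.* (H ℕ.+ B ℕ.* q)) ℕ.+ F ℕ.* R ℕ.* (B ℕ.* q)
    ≡⟨ e₄ F R a k² q H B ⟩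
  F ℕ.* R ℕ.* q ℕ.+ (F ℕ.* R ℕ.* (a ℕ.* k² ℕ.* q) ℕ.+ R ℕ.* (F ℕ.* a ℕ.* q) ℕ.+ (F ℕ.* a ℕ.* H ℕ.+ F ℕ.* a ℕ.* (B ℕ.* q))) ℕ.+ F ℕ.* R ℕ.* (B ℕ.* q)
    ≤⟨ ℕ.+-monoˡ-≤ _ (ℕ.+-monoʳ-≤ (F ℕ.* R ℕ.* q) (ℕ.+-monoʳ-≤ (F ℕ.* R ℕ.* (a ℕ.* k² ℕ.* q) ℕ.+ R ℕ.* (F ℕ.* a ℕ.* q))
         (ℕ.+-monoʳ-≤ (F ℕ.* a ℕ.* H) (growR (F ℕ.* a ℕ.* (B ℕ.* q)))))) ⟩
  F ℕ.* R ℕ.* q ℕ.+ (F ℕ.* R ℕ.* (a ℕ.* k² ℕ.* q) ℕ.+ R ℕ.* (F ℕ.* a ℕ.* q) ℕ.+ (F ℕ.* a ℕ.* H ℕ.+ R ℕ.* (F ℕ.* a ℕ.* (B ℕ.* q)))) ℕ.+ F ℕ.* R ℕ.* (B ℕ.* q)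
    ≡⟨ e₅ F R a k² q H B ⟩
  F ℕ.* (R ℕ.* ((1 ℕ.+ a ℕ.* k² ℕ.+ a ℕ.* B ℕ.+ a ℕ.+ B) ℕ.* q) ℕ.+ a ℕ.* H) ∎)
  where
  open ℕ.≤-Reasoning
  q = n ℕ.* n
  n≤q : n ≤ q
  n≤q = ℕ.m≤m*n n n {{ℕ.>-nonZero 1≤n}}
  grow : ∀ {c} b → 1 ≤ c → b ≤ c ℕ.* b
  grow {c} b 1≤c = ℕ.m≤n*m b c {{ℕ.>-nonZero 1≤c}}
  growR : ∀ b → b ≤ R ℕ.* b
  growR b = grow b 1≤R
  e₁ : ∀ F R m n B q → F ℕ.* (R ℕ.* (m ℕ.* n ℕ.+ B ℕ.* q)) ≡ R ℕ.* F ℕ.* m ℕ.* n ℕ.+ F ℕ.* R ℕ.* (B ℕ.* q)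
  e₁ = ℕ-Ring.solve-∀
  e₂ : ∀ R F a n q B → (R ℕ.* F ℕ.+ a ℕ.* q) ℕ.* n ℕ.+ F ℕ.* R ℕ.* (B ℕ.* q)
     ≡ F ℕ.* R ℕ.* n ℕ.+ a ℕ.* n ℕ.* q ℕ.+ F ℕ.* R ℕ.* (B ℕ.* q)
  e₂ = ℕ-Ring.solve-∀
  e₃ : ∀ F R a n k m B →
    F ℕ.* R ℕ.* (n ℕ.* n) ℕ.+ a ℕ.* n ℕ.* (k ℕ.* n ℕ.+ F ℕ.* suc m) ℕ.+ F ℕ.* R ℕ.* (B ℕ.* (n ℕ.* n))
    ≡ F ℕ.* R ℕ.* (n ℕ.* n) ℕ.+ (a ℕ.* k ℕ.* (n ℕ.* n) ℕ.+ F ℕ.* a ℕ.* n ℕ.+ F ℕ.* a ℕ.* (m ℕ.* n)) ℕ.+ F ℕ.* R ℕ.* (B ℕ.* (n ℕ.* n))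
  e₃ = ℕ-Ring.solve-∀
  e₄ : ∀ F R a k q H B →
    F ℕ.* R ℕ.* q ℕ.+ (F ℕ.* R ℕ.* (a ℕ.* k ℕ.* q) ℕ.+ R ℕ.* (F ℕ.* a ℕ.* q) ℕ.+ F ℕ.* a ℕ.* (H ℕ.+ B ℕ.* q)) ℕ.+ F ℕ.* R ℕ.* (B ℕ.* q)
    ≡ F ℕ.* R ℕ.* q ℕ.+ (F ℕ.* R ℕ.* (a ℕ.* k ℕ.* q) ℕ.+ R ℕ.* (F ℕ.* a ℕ.* q) ℕ.+ (F ℕ.* a ℕ.* H ℕ.+ F ℕ.* a ℕ.* (B ℕ.* q))) ℕ.+ F ℕ.* R ℕ.* (B ℕ.* q)
  e₄ = ℕ-Ring.solve-∀
  e₅ : ∀ F R a k q H B →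
    F ℕ.* R ℕ.* q ℕ.+ (F ℕ.* R ℕ.* (a ℕ.* k ℕ.* q) ℕ.+ R ℕ.* (F ℕ.* a ℕ.* q) ℕ.+ (F ℕ.* a ℕ.* H ℕ.+ R ℕ.* (F ℕ.* a ℕ.* (B ℕ.* q)))) ℕ.+ F ℕ.* R ℕ.* (B ℕ.* q)
    ≡ F ℕ.* (R ℕ.* ((1 ℕ.+ a ℕ.* k ℕ.+ a ℕ.* B ℕ.+ a ℕ.+ B) ℕ.* q) ℕ.+ a ℕ.* H)
  e₅ = ℕ-Ring.solve-∀

-- The hypotheses give n³ ≤ F H + E n² with E = k² + F B + F. For n ≥ 2 E the error is at most half
-- of n³, whence the factor 2 F.
edges-arithmetic : ∀ F B k² n m′ H → 1 ≤ n → 2 ℕ.* (k² ℕ.+ F ℕ.* B ℕ.+ F) ≤ n →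
  n ℕ.* n ≤ k² ℕ.* n ℕ.+ F ℕ.* suc m′ →
  m′ ℕ.* n ≤ H ℕ.+ B ℕ.* (n ℕ.* n) →
  n ℕ.* (n ℕ.* n) ≤ 2 ℕ.* F ℕ.* H
edges-arithmetic F B k² n m′ H 1≤n n-large n²≤ H≥ = ℕ.+-cancelʳ-≤ (n ℕ.* q) _ _ (begin
  n ℕ.* q ℕ.+ n ℕ.* q                                          ≤⟨ ℕ.+-mono-≤ n³≤ n³≤ ⟩
  (F ℕ.* H ℕ.+ E ℕ.* q) ℕ.+ (F ℕ.* H ℕ.+ E ℕ.* q)              ≡⟨ double F H E q ⟩
  2 ℕ.* F ℕ.* H ℕ.+ 2 ℕ.* E ℕ.* q                              ≤⟨ ℕ.+-monoʳ-≤ (2 ℕ.* F ℕ.* H) (ℕ.*-monoˡ-≤ q n-large) ⟩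
  2 ℕ.* F ℕ.* H ℕ.+ n ℕ.* q                                    ∎)
  where
  open ℕ.≤-Reasoning
  q = n ℕ.* n
  E = k² ℕ.+ F ℕ.* B ℕ.+ F
  n≤q : n ≤ q
  n≤q = ℕ.m≤m*n n n {{ℕ.>-nonZero 1≤n}}
  double : ∀ F H E q → (F ℕ.* H ℕ.+ E ℕ.* q) ℕ.+ (F ℕ.* H ℕ.+ E ℕ.* q) ≡ 2 ℕ.* F ℕ.* H ℕ.+ 2 ℕ.* E ℕ.* q
  double = ℕ-Ring.solve-∀
  expand : ∀ n k F m → n ℕ.* (k ℕ.* n ℕ.+ F ℕ.* suc m) ≡ k ℕ.* (n ℕ.* n) ℕ.+ (F ℕ.* (m ℕ.* n) ℕ.+ F ℕ.* n)
  expand = ℕ-Ring.solve-∀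
  collect : ∀ k q F H B → k ℕ.* q ℕ.+ (F ℕ.* (H ℕ.+ B ℕ.* q) ℕ.+ F ℕ.* q) ≡ F ℕ.* H ℕ.+ (k ℕ.+ F ℕ.* B ℕ.+ F) ℕ.* q
  collect = ℕ-Ring.solve-∀
  n³≤ : n ℕ.* q ≤ F ℕ.* H ℕ.+ E ℕ.* q
  n³≤ = begin
    n ℕ.* q                                                    ≤⟨ ℕ.*-monoʳ-≤ n n²≤ ⟩
    n ℕ.* (k² ℕ.* n ℕ.+ F ℕ.* suc m′)                          ≡⟨ expand n k² F m′ ⟩
    k² ℕ.* q ℕ.+ (F ℕ.* (m′ ℕ.* n) ℕ.+ F ℕ.* n)                ≤⟨ ℕ.+-monoʳ-≤ (k² ℕ.* q) (ℕ.+-mono-≤ (ℕ.*-monoʳ-≤ F H≥) (ℕ.*-monoʳ-≤ F n≤q)) ⟩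
    k² ℕ.* q ℕ.+ (F ℕ.* (H ℕ.+ B ℕ.* q) ℕ.+ F ℕ.* q)           ≡⟨ collect k² q F H B ⟩
    F ℕ.* H ℕ.+ E ℕ.* q                                        ∎

-- The left side is K³ n⁶, and squaring the hypothesis costs G²; one more factor G ≥ 1 completes the
-- cube.
cube-bound : ∀ K G n H → 1 ≤ G → n ℕ.* (n ℕ.* n) ≤ G ℕ.* H →
  (K ℕ.* n ℕ.^ 2) ℕ.^ 3 ≤ (K ℕ.* G) ℕ.^ 3 ℕ.* H ℕ.^ 2
cube-bound K G n H 1≤G n³≤ = begin
  (K ℕ.* n ℕ.^ 2) ℕ.^ 3                     ≡⟨ e₁ K n ⟩
  K ℕ.^ 3 ℕ.* (n³ ℕ.* n³)                   ≤⟨ ℕ.*-monoʳ-≤ (K ℕ.^ 3) (ℕ.*-mono-≤ n³≤ n³≤) ⟩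
  K ℕ.^ 3 ℕ.* (G ℕ.* H ℕ.* (G ℕ.* H))       ≤⟨ ℕ.*-monoʳ-≤ (K ℕ.^ 3) (ℕ.m≤n*m _ G {{ℕ.>-nonZero 1≤G}}) ⟩
  K ℕ.^ 3 ℕ.* (G ℕ.* (G ℕ.* H ℕ.* (G ℕ.* H))) ≡⟨ e₂ K G H ⟩
  (K ℕ.* G) ℕ.^ 3 ℕ.* H ℕ.^ 2               ∎
  where
  open ℕ.≤-Reasoning
  n³ = n ℕ.* (n ℕ.* n)
  e₁ : ∀ K n → (K ℕ.* (n ℕ.* (n ℕ.* 1))) ℕ.* ((K ℕ.* (n ℕ.* (n ℕ.* 1))) ℕ.* ((K ℕ.* (n ℕ.* (n ℕ.* 1))) ℕ.* 1))
     ≡ K ℕ.* (K ℕ.* (K ℕ.* 1)) ℕ.* (n ℕ.* (n ℕ.* n) ℕ.* (n ℕ.* (n ℕ.* n)))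
  e₁ = ℕ-Ring.solve-∀
  e₂ : ∀ K G H → K ℕ.* (K ℕ.* (K ℕ.* 1)) ℕ.* (G ℕ.* (G ℕ.* H ℕ.* (G ℕ.* H)))
     ≡ (K ℕ.* G) ℕ.* ((K ℕ.* G) ℕ.* ((K ℕ.* G) ℕ.* 1)) ℕ.* (H ℕ.* (H ℕ.* 1))
  e₂ = ℕ-Ring.solve-∀

n<[1+n/d]*d : ∀ n d .{{_ : ℕ.NonZero d}} → n < suc (n ℕ./ d) ℕ.* d
n<[1+n/d]*d n d = subst (_< suc (n ℕ./ d) ℕ.* d) (sym (ℕ.m≡m%n+[m/n]*n n d))
  (ℕ.+-monoˡ-< (n ℕ./ d ℕ.* d) (ℕ.m%n<n n d))

-- With δ = 1/(b n), the choice b = a + 2 makes m δ² ≤ 1/2 for m ≈ a n² / (R F); B n² is the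
-- deviation N d of the tail bounds; K collects the O(n²) errors of the expectation and of both tails.
module Constants (k r : ℕ) (3<k : 3 < k) (2≤r : 2 ≤ r) where

  a R F b B K D : ℕ
  a = stirling2 k r ℕ.* r !
  R = r ℕ.^ k
  F = k !
  b = a ℕ.+ 2
  B = b ℕ.* (r ℕ.+ 3)
  K = 1 ℕ.+ a ℕ.* (k ℕ.* k) ℕ.+ a ℕ.* B ℕ.+ a ℕ.+ B
  D = K ℕ.* (2 ℕ.* F)

  instance
    r≢0 : ℕ.NonZero r
    r≢0 = ℕ.>-nonZero (ℕ.≤-trans (s≤s z≤n) 2≤r)
    R≢0 : ℕ.NonZero R
    R≢0 = ℕ.m^n≢0 r k
    F≢0 : ℕ.NonZero F
    F≢0 = k ℕ.!≢0
    RF≢0 : ℕ.NonZero (R ℕ.* F)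
    RF≢0 = ℕ.m*n≢0 R F

  failure : ∀ n → 1 ≤ n → 2 ℕ.* (k ℕ.* k ℕ.+ F ℕ.* B ℕ.+ F) ≤ n →
    2ℚ ^ n * (1ℚ - Prob k n (goodEvent k r K D n)) ≤ℚ 1ℚ
  failure n 1≤n n-large = failure-bound k r K D n M m m′ N refl 1≤n
    (ℕ.*-mono-≤ (ℕ.m≤n+m 2 a) 1≤n) 2m≤NN 2m′≤NN cut-size
    (subst (M ℕ.* (m′ ℕ.* n) ≤_) (sym (tally-true (kSets n k))) edge-size)
    (λ H many c few → excess-≤ k r H c (K ℕ.* n ℕ.^ 2)
      (subst (λ q → R ℕ.* cutSize H c ≤ R ℕ.* (K ℕ.* q) ℕ.+ a ℕ.* edges H) (sym n²≡q)
        (excess-arithmetic a R F B (k ℕ.* k) n m m′ (cutSize H c) (edges H) 1≤n (ℕ.>-nonZero⁻¹ F) (ℕ.>-nonZero⁻¹ R) RFm≤ n²≤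
          (subst (λ x → cutSize H c ≤ m ℕ.* n ℕ.+ x) Nd≡Bq few)
          (subst (λ x → m′ ℕ.* n ≤ edges H ℕ.+ x) Nd≡Bq many))))
    (λ H many → cube-bound K (2 ℕ.* F) n (edges H) (ℕ.*-mono-≤ {1} {2} (s≤s z≤n) (ℕ.>-nonZero⁻¹ F))
      (edges-arithmetic F B (k ℕ.* k) n m′ (edges H) 1≤n n-large n²≤
        (subst (λ x → m′ ℕ.* n ≤ edges H ℕ.+ x) Nd≡Bq many)))
    where
    open ℕ.≤-Reasoning
    instance
      n≢0 : ℕ.NonZero n
      n≢0 = ℕ.>-nonZero 1≤n
    M N q : ℕ
    M = n ℕ.^ (k ℕ.∸ 3)
    N = b ℕ.* n
    q = n ℕ.* n
    instance
      M≢0 : ℕ.NonZero M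
      M≢0 = ℕ.m^n≢0 n (k ℕ.∸ 3)
      Mn≢0 : ℕ.NonZero (M ℕ.* n)
      Mn≢0 = ℕ.m*n≢0 M n
      N≢0 : ℕ.NonZero N
      N≢0 = ℕ.m*n≢0 b n {{ℕ.>-nonZero (ℕ.≤-trans (s≤s z≤n) (ℕ.m≤n+m 2 a))}}
    -- The rounding directions are forced: M m n must bound the number of crossing k-sets from
    -- above, and M m′ n must bound the number of all k-sets from below.
    m m′ : ℕ
    m  = suc (a ℕ.* q ℕ./ (R ℕ.* F))
    m′ = (n choose k) ℕ./ (M ℕ.* n)
    n²≡q : n ℕ.^ 2 ≡ q
    n²≡q = cong (n ℕ.*_) (ℕ.*-identityʳ n)
    n^k≡Mn³ : n ℕ.^ k ≡ M ℕ.* n ℕ.* q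
    n^k≡Mn³ = trans (cong (n ℕ.^_) (sym (ℕ.m+[n∸m]≡n (ℕ.<⇒≤ 3<k)))) (assemble n M)
      where
      assemble : ∀ n M → n ℕ.* (n ℕ.* (n ℕ.* M)) ≡ M ℕ.* n ℕ.* (n ℕ.* n)
      assemble = ℕ-Ring.solve-∀
    Nd≡Bq : N ℕ.* ((r ℕ.+ 2) ℕ.* n ℕ.+ n) ≡ B ℕ.* q
    Nd≡Bq = regroup b n r
      where
      regroup : ∀ b n r → b ℕ.* n ℕ.* ((r ℕ.+ 2) ℕ.* n ℕ.+ n) ≡ b ℕ.* (r ℕ.+ 3) ℕ.* (n ℕ.* n)
      regroup = ℕ-Ring.solve-∀
    RFm≤ : R ℕ.* F ℕ.* m ≤ R ℕ.* F ℕ.+ a ℕ.* q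
    RFm≤ = begin
      R ℕ.* F ℕ.* m                                              ≡⟨ ℕ.*-comm (R ℕ.* F) m ⟩
      R ℕ.* F ℕ.+ a ℕ.* q ℕ./ (R ℕ.* F) ℕ.* (R ℕ.* F)            ≤⟨ ℕ.+-monoʳ-≤ (R ℕ.* F) (ℕ.m/n*n≤m (a ℕ.* q) (R ℕ.* F)) ⟩
      R ℕ.* F ℕ.+ a ℕ.* q                                        ∎
    cut-size : ∀ c → tally (crosses {n} {r} c) (kSets n k) ≤ M ℕ.* (m ℕ.* n)
    cut-size c = ℕ.*-cancelˡ-≤ (R ℕ.* F) (begin
      R ℕ.* F ℕ.* tally (crosses c) (kSets n k)   ≤⟨ crosses-bound k c ⟩
      a ℕ.* n ℕ.^ k                               ≡⟨ cong (a ℕ.*_) n^k≡Mn³ ⟩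
      a ℕ.* (M ℕ.* n ℕ.* q)                       ≡⟨ e₁ a (M ℕ.* n) q ⟩
      M ℕ.* n ℕ.* (a ℕ.* q)                       ≤⟨ ℕ.*-monoʳ-≤ (M ℕ.* n) (ℕ.<⇒≤ (n<[1+n/d]*d (a ℕ.* q) (R ℕ.* F))) ⟩
      M ℕ.* n ℕ.* (m ℕ.* (R ℕ.* F))               ≡⟨ e₂ M n m (R ℕ.* F) ⟩
      R ℕ.* F ℕ.* (M ℕ.* (m ℕ.* n))               ∎)
      where
      e₁ : ∀ a x q → a ℕ.* (x ℕ.* q) ≡ x ℕ.* (a ℕ.* q)
      e₁ = ℕ-Ring.solve-∀
      e₂ : ∀ M n m x → M ℕ.* n ℕ.* (m ℕ.* x) ≡ x ℕ.* (M ℕ.* (m ℕ.* n))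
      e₂ = ℕ-Ring.solve-∀
    edge-size : M ℕ.* (m′ ℕ.* n) ≤ length (kSets n k)
    edge-size = begin
      M ℕ.* (m′ ℕ.* n)         ≡⟨ rotate M m′ n ⟩
      m′ ℕ.* (M ℕ.* n)         ≤⟨ ℕ.m/n*n≤m (n choose k) (M ℕ.* n) ⟩
      n choose k                    ≡⟨ sym (length-kSets n k) ⟩
      length (kSets n k)       ∎
      where
      rotate : ∀ M m n → M ℕ.* (m ℕ.* n) ≡ m ℕ.* (M ℕ.* n)
      rotate = ℕ-Ring.solve-∀
    -- This is `n^1+k≤` divided by M n², with the quotient C(n, k) / (M n) rounded up to `suc m′`.
    n²≤ : q ≤ k ℕ.* k ℕ.* n ℕ.+ F ℕ.* suc m′
    n²≤ = ℕ.*-cancelˡ-≤ (M ℕ.* n ℕ.* n) {{ℕ.m*n≢0 (M ℕ.* n) n}} (begin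
      M ℕ.* n ℕ.* n ℕ.* q                       ≡⟨ e₁ (M ℕ.* n) n q ⟩
      n ℕ.* (M ℕ.* n ℕ.* q)                     ≡⟨ cong (n ℕ.*_) (sym n^k≡Mn³) ⟩
      n ℕ.* n ℕ.^ k                             ≤⟨ n^1+k≤ k n ⟩
      n ℕ.* (F ℕ.* (n choose k)) ℕ.+ k ℕ.* k ℕ.* n ℕ.^ k
        ≤⟨ ℕ.+-monoˡ-≤ _ (ℕ.*-monoʳ-≤ n (ℕ.*-monoʳ-≤ F (ℕ.<⇒≤ (n<[1+n/d]*d (n choose k) (M ℕ.* n))))) ⟩
      n ℕ.* (F ℕ.* (suc m′ ℕ.* (M ℕ.* n))) ℕ.+ k ℕ.* k ℕ.* n ℕ.^ k
        ≡⟨ cong (λ x → n ℕ.* (F ℕ.* (suc m′ ℕ.* (M ℕ.* n))) ℕ.+ k ℕ.* k ℕ.* x) n^k≡Mn³ ⟩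
      n ℕ.* (F ℕ.* (suc m′ ℕ.* (M ℕ.* n))) ℕ.+ k ℕ.* k ℕ.* (M ℕ.* n ℕ.* q)
        ≡⟨ e₂ n F (suc m′) M (k ℕ.* k) ⟩
      M ℕ.* n ℕ.* n ℕ.* (k ℕ.* k ℕ.* n ℕ.+ F ℕ.* suc m′) ∎)
      where
      e₁ : ∀ x n q → x ℕ.* n ℕ.* q ≡ n ℕ.* (x ℕ.* q)
      e₁ = ℕ-Ring.solve-∀
      e₂ : ∀ n F s M k → n ℕ.* (F ℕ.* (s ℕ.* (M ℕ.* n))) ℕ.+ k ℕ.* (M ℕ.* n ℕ.* (n ℕ.* n))
         ≡ M ℕ.* n ℕ.* n ℕ.* (k ℕ.* n ℕ.+ F ℕ.* s)
      e₂ = ℕ-Ring.solve-∀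
    1≤q : 1 ≤ q
    1≤q = ℕ.*-mono-≤ 1≤n 1≤n
    2m≤NN : 2 ℕ.* m ≤ N ℕ.* N
    2m≤NN = begin
      2 ℕ.* m                                      ≤⟨ ℕ.*-monoʳ-≤ 2 (s≤s (ℕ.m/n≤m (a ℕ.* q) (R ℕ.* F))) ⟩
      2 ℕ.* (1 ℕ.+ a ℕ.* q)                        ≤⟨ ℕ.*-monoʳ-≤ 2 (ℕ.+-monoˡ-≤ (a ℕ.* q) 1≤q) ⟩
      -- The padding completes a square: 2 (1 + a) + (a² + 2 a + 2) = (a + 2)².
      2 ℕ.* (q ℕ.+ a ℕ.* q)                        ≤⟨ ℕ.m≤m+n _ ((a ℕ.* a ℕ.+ 2 ℕ.* a ℕ.+ 2) ℕ.* q) ⟩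
      2 ℕ.* (q ℕ.+ a ℕ.* q) ℕ.+ (a ℕ.* a ℕ.+ 2 ℕ.* a ℕ.+ 2) ℕ.* q ≡⟨ square a n ⟩
      N ℕ.* N                                      ∎
      where
      square : ∀ a n → 2 ℕ.* (n ℕ.* n ℕ.+ a ℕ.* (n ℕ.* n)) ℕ.+ (a ℕ.* a ℕ.+ 2 ℕ.* a ℕ.+ 2) ℕ.* (n ℕ.* n)
        ≡ (a ℕ.+ 2) ℕ.* n ℕ.* ((a ℕ.+ 2) ℕ.* n)
      square = ℕ-Ring.solve-∀
    m′≤q : m′ ≤ q
    m′≤q = ℕ.*-cancelˡ-≤ (M ℕ.* n) (begin
      M ℕ.* n ℕ.* m′           ≡⟨ ℕ.*-comm (M ℕ.* n) m′ ⟩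
      m′ ℕ.* (M ℕ.* n)         ≤⟨ ℕ.m/n*n≤m (n choose k) (M ℕ.* n) ⟩
      n choose k                    ≤⟨ ℕ.m≤n*m (n choose k) F ⟩
      F ℕ.* (n choose k)            ≤⟨ k!*nCk≤n^k k n ⟩
      n ℕ.^ k                  ≡⟨ n^k≡Mn³ ⟩
      M ℕ.* n ℕ.* q            ∎)
    2m′≤NN : 2 ℕ.* m′ ≤ N ℕ.* N
    2m′≤NN = begin
      2 ℕ.* m′                  ≤⟨ ℕ.*-mono-≤ {2} {b ℕ.* b} (ℕ.≤-trans (ℕ.m≤n+m 2 a) (ℕ.m≤m*n b b {{ℕ.>-nonZero (ℕ.≤-trans (s≤s z≤n) (ℕ.m≤n+m 2 a))}})) m′≤q ⟩
      b ℕ.* b ℕ.* q             ≡⟨ square b n ⟩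
      N ℕ.* N                   ∎
      where
      square : ∀ b n → b ℕ.* b ℕ.* (n ℕ.* n) ≡ b ℕ.* n ℕ.* (b ℕ.* n)
      square = ℕ-Ring.solve-∀

theorem1p3 : (k r : ℕ) → 3 < k → 2 ≤ r → r ≤ k →
    Σ ℕ λ C → Σ ℕ λ D →
    (ε : ℚ) → 0ℚ <ℚ ε →
    Σ ℕ λ N → (n : ℕ) → N ≤ n →
    1ℚ - ε ≤ℚ Prob k n (goodEvent k r C D n)
theorem1p3 k r 3<k 2≤r r≤k = K , D , λ ε 0<ε →
  -- The failure probability is at most 2^(-n), and 2^n ≥ n ≥ N₀ brings it below ε. N₁ is the
  -- threshold of `edges-arithmetic`, and the successor ensures n ≥ 1.
  let N₀ , 1≤N₀ε = archimedean ε 0<ε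
      N₁ = 2 ℕ.* (k ℕ.* k ℕ.+ F ℕ.* B ℕ.+ F)
  in suc (N₀ ℕ.+ N₁) , λ n N≤n →
    complement-≤ ε _ (*-cancelˡ (2ℚ ^ n) (^-pos n (ι-pos 1)) (begin
      2ℚ ^ n * (1ℚ - Prob k n (goodEvent k r K D n))
        ≤⟨ failure n (ℕ.≤-trans (s≤s z≤n) N≤n) (ℕ.≤-trans (ℕ.m≤n⇒m≤1+n (ℕ.m≤n+m N₁ N₀)) N≤n) ⟩
      1ℚ
        ≤⟨ 1≤N₀ε ⟩
      ι N₀ * ε
        ≤⟨ *-monoʳ (ℚ.<⇒≤ 0<ε) (ι-mono (ℕ.≤-trans (ℕ.≤-trans (ℕ.m≤n⇒m≤1+n (ℕ.m≤m+n N₀ N₁)) N≤n) (n≤2^n n))) ⟩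
      ι (2 ℕ.^ n) * ε
        ≡⟨ cong (_* ε) (ι-^ 2 n) ⟩
      2ℚ ^ n * ε ∎))
  where
  open Constants k r 3<k 2≤r
  open ℚ.≤-Reasoning
  complement-≤ : ∀ ε p → 1ℚ - p ≤ℚ ε → 1ℚ - ε ≤ℚ p
  complement-≤ ε p h = nonneg-sub (subst (0ℚ ≤ℚ_) (swap ε p) (sub-nonneg h))
    where
    swap : ∀ ε p → ε - (1ℚ - p) ≡ p - (1ℚ - ε)
    swap = solve-∀ ℚ-ring
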